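{- Token Swapping restricted to lollipop graphs can be solved in polynomial time: given $m,n$, the lollipop graph $L_{m,n}$ and a configuration $f$ on $L_{m,n}$, the value $\mathsf{ts}(L_{m,n},f)$ (and hence whether $\mathsf{ts}(L_{m,n},f)\le k$ for a given $k$) can be computed in time polynomial in $m+n$.
   Context: The lollipop graph $L_{m,n}$ has vertex set $\{ -m,\dots,-1,0,1,\dots,n\}$ and edge set $\{\{i,j\}\mid i<j\le 0\}\cup\{\{i,i+1\}\mid 0\le i<n\}$ (a complete graph on $\{ -m,\dots,0\}$ attached to the path $0,1,\dots,n$). A configuration on a graph $G=(V,E)$ is a bijection $f:V\to V$. A swap $e=\{u,v\}\in E$ applied to $f$ gives $fe$ with $fe(u)=f(v)$, $fe(v)=f(u)$, $fe(w)=f(w)$ otherwise; sequences are applied left to right. $\mathsf{ts}(G,f)$ is the minimum length of a swap sequence turning $f$ into the identity map. -}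

module Defs where

open import Data.Nat using (ℕ; zero; suc; _+_; _*_; _∸_; _^_; _≤_; _<_; _≡ᵇ_)
open import Data.Fin using (Fin; toℕ)
import Data.Fin as Fin
open import Data.Fin.Properties using (_≟_)
open import Data.List using (List; []; _∷_; foldl; length)
open import Data.Maybe using (Maybe; just; nothing)
open import Data.Product using (Σ; _×_; _,_)
open import Data.Sum using (_⊎_)
open import Data.Bool using (Bool; true; false; if_then_else_)
open import Relation.Nullary using (yes; no)
open import Relation.Binary.PropositionalEquality using (_≡_)

-- The lollipop graph L_{m,n}.
-- Vertex v ∈ {-m,…,n} is represented by the index v + m ∈ Fin (suc (m + n)).
-- So index i ≤ m  ⇔  vertex ≤ 0.

Vertex : ℕ → ℕ → Set
Vertex m n = Fin (suc (m + n))

-- Ordered edge relation on indices i < j: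
--   {i,j} with both vertices ≤ 0 (clique part), or
--   {i,i+1} with vertex i ≥ 0 (path part).
LAdj : ℕ → ℕ → ℕ → Set
LAdj m i j = i < j × (j ≤ m ⊎ (m ≤ i × j ≡ suc i))

Adj : (m n : ℕ) → Vertex m n → Vertex m n → Set
Adj m n u v = LAdj m (toℕ u) (toℕ v) ⊎ LAdj m (toℕ v) (toℕ u)

record Edge (m n : ℕ) : Set where
  constructor edge
  field
    u v  : Vertex m n
    adj  : Adj m n u v

Config : ℕ → ℕ → Set
Config m n = Vertex m n → Vertex m n

swap : ∀ {m n} → Config m n → Edge m n → Config m n
swap f (edge u v _) w with w ≟ u
... | yes _ = f v
... | no _ with w ≟ v
...   | yes _ = f u
...   | no _  = f w

applySeq : ∀ {m n} → Config m n → List (Edge m n) → Config m n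
applySeq {m} {n} f es = foldl (swap {m} {n}) f es

IsIdentity : (m n : ℕ) → Config m n → Set
IsIdentity m n f = ∀ w → f w ≡ w

IsTS : (m n : ℕ) → Config m n → ℕ → Set
IsTS m n f k =
  Σ (List (Edge m n)) (λ es → length es ≡ k × IsIdentity m n (applySeq f es))
  × (∀ (es : List (Edge m n)) → IsIdentity m n (applySeq f es) → k ≤ length es)

-- Model of computation: unit-cost RAM with natural-number registers,
-- addition, truncated subtraction, indirect addressing, conditional jump.
-- (Polynomially equivalent to Turing machines.)

data Instr : Set where
  const : (r k : ℕ) → Instr
  add   : (r a b : ℕ) → Instr
  sub   : (r a b : ℕ) → Instr
  load  : (r a : ℕ) → Instr
  store : (a r : ℕ) → Instr
  jz    : (a l : ℕ) → Instr
  jmp   : (l : ℕ) → Instr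

Program : Set
Program = List Instr

record State : Set where
  constructor st
  field
    pc  : ℕ
    mem : ℕ → ℕ
open State public

fetch : Program → ℕ → Maybe Instr
fetch []      _       = nothing
fetch (i ∷ _) zero    = just i
fetch (_ ∷ p) (suc k) = fetch p k

update : (ℕ → ℕ) → ℕ → ℕ → (ℕ → ℕ)
update m a v x = if x ≡ᵇ a then v else m x

exec : Instr → State → State
exec (const r k)   (st p m) = st (suc p) (update m r k)
exec (add r a b)   (st p m) = st (suc p) (update m r (m a + m b))
exec (sub r a b)   (st p m) = st (suc p) (update m r (m a ∸ m b))
exec (load r a)    (st p m) = st (suc p) (update m r (m (m a)))
exec (store a r)   (st p m) = st (suc p) (update m (m a) (m r))
exec (jz a l)      (st p m) = if m a ≡ᵇ 0 then st l m else st (suc p) m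
exec (jmp l)       (st p m) = st l m

-- The machine halts when pc points outside the program.
-- run P t s = just s' iff P started in s halts within t steps in state s'.
run : Program → ℕ → State → Maybe State
run P t s with fetch P (pc s)
run P t       s | nothing = just s
run P zero    s | just _  = nothing
run P (suc t) s | just i  = run P t (exec i s)

-- Input encoding: R[0] = m, R[1] = n, R[2+i] = index of f(i) for
-- i ∈ {0,…,m+n} (vertex encodings as above), all other registers 0.
inputMem : (m n : ℕ) → Config m n → ℕ → ℕ
inputMem m n f zero          = m
inputMem m n f (suc zero)    = n
inputMem m n f (suc (suc i)) = enc (suc (m + n)) f i
  where
  enc : (N : ℕ) → (Fin N → Fin (suc (m + n))) → ℕ → ℕ
  enc zero    g i       = 0
  enc (suc N) g zero    = toℕ (g Fin.zero)
  enc (suc N) g (suc i) = enc N (λ x → g (Fin.suc x)) i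

initState : (m n : ℕ) → Config m n → State
initState m n f = st 0 (inputMem m n f)

{-# OPTIONS --safe #-}

-- Recursive sorting: bring the token k with the largest index home along a
-- shortest path and continue on the lollipop without vertex k; once only the
-- clique is left, its last vertex plays the role of the end of the path.  The
-- number of swaps is optimal because, as a function of the configuration, it
-- changes by at most one under any swap.  To see this, compare the two
-- configurations after token k has gone home: if the swapped edge avoids k,
-- they differ by a swap along an edge of the smaller graph; if it moves k along
-- its shortest path, they are equal and the distance of k has changed by one;
-- if it moves k inside the clique away from the hub, they differ by that same
-- swap and the distance of k is unchanged.
--
-- A RAM program runs this procedure in quadratic time.  For k = m + n, …, 1 it
-- sweeps i = 0, …, k − 1 and, whenever vertex i holds token k, swaps i with its
-- successor on the shortest path from i to k.

module Submission where

open import Defs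
open import Data.Bool using (true; false; T)
open import Data.Fin using (Fin; toℕ; fromℕ<)
import Data.Fin as Fin
import Data.Fin.Properties as Fin
open import Data.List using (List; []; _∷_; _++_; length; replicate)
open import Data.Maybe using (just; nothing)
open import Data.Nat
open import Data.Nat.Properties
open import Data.Nat.Tactic.RingSolver using (solve-∀)
open import Data.Product using (Σ; _×_; _,_; proj₁; proj₂)
open import Data.Sum using (_⊎_; inj₁; inj₂)
import Data.Sum as Sum
open import Data.Unit using (⊤; tt)
open import Function using (_∘_)
open import Function.Definitions using (Bijective)
open import Relation.Binary.Definitions using (tri<; tri≈; tri>)
open import Relation.Binary.PropositionalEquality
open import Relation.Nullary using (Dec; yes; no; contradiction)

-- Transpositions of natural numbers

transpose : ℕ → ℕ → ℕ → ℕ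
transpose u v x with x ≟ u
... | yes _ = v
... | no _ with x ≟ v
...   | yes _ = u
...   | no _  = x

transpose-matchˡ : ∀ u v → transpose u v u ≡ v
transpose-matchˡ u v with u ≟ u
... | yes _  = refl
... | no u≢u = contradiction refl u≢u

transpose-matchʳ : ∀ u v → transpose u v v ≡ u
transpose-matchʳ u v with v ≟ u
... | yes v≡u = v≡u
... | no _ with v ≟ v
...   | yes _  = refl
...   | no v≢v = contradiction refl v≢v

transpose-mismatch : ∀ {u v x} → x ≢ u → x ≢ v → transpose u v x ≡ x
transpose-mismatch {u} {v} {x} x≢u x≢v with x ≟ u
... | yes x≡u = contradiction x≡u x≢u
... | no _ with x ≟ v
...   | yes x≡v = contradiction x≡v x≢v
...   | no _    = refl

-- The value is an index, so matching on a view also settles `transpose u v x` in the goal.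
data TransposeView (u v : ℕ) : ℕ → ℕ → Set where
  left  : TransposeView u v u v
  right : TransposeView u v v u
  other : ∀ {x} → x ≢ u → x ≢ v → TransposeView u v x x

transposeView : ∀ u v x → TransposeView u v x (transpose u v x)
transposeView u v x with x ≟ u
... | yes refl = left
... | no x≢u with x ≟ v
...   | yes refl = right
...   | no x≢v   = other x≢u x≢v

transpose-comm : ∀ u v x → transpose u v x ≡ transpose v u x
transpose-comm u v x with transpose u v x | transposeView u v x
... | _ | left          = sym (transpose-matchʳ v u)
... | _ | right         = sym (transpose-matchˡ v u)
... | _ | other x≢u x≢v = sym (transpose-mismatch x≢v x≢u)

transpose-involutive : ∀ u v x → transpose u v (transpose u v x) ≡ x
transpose-involutive u v x with transpose u v x | transposeView u v x
... | _ | left          = transpose-matchʳ u v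
... | _ | right         = transpose-matchˡ u v
... | _ | other x≢u x≢v = transpose-mismatch x≢u x≢v

transpose-< : ∀ {u v N x} → u < N → v < N → x < N → transpose u v x < N
transpose-< {u} {v} {x = x} u<N v<N x<N with transpose u v x | transposeView u v x
... | _ | left      = v<N
... | _ | right     = u<N
... | _ | other _ _ = x<N

transpose-injective : ∀ u v {x y} → transpose u v x ≡ transpose u v y → x ≡ y
transpose-injective u v {x} {y} eq =
  trans (sym (transpose-involutive u v x))
        (trans (cong (transpose u v) eq) (transpose-involutive u v y))

-- Injectivity of `φ` is asked only for the two comparisons made, because `bypass h p` is injective
-- only away from p.
transpose-conjugate : ∀ (φ : ℕ → ℕ) {u v x} → (φ x ≡ φ u → x ≡ u) → (φ x ≡ φ v → x ≡ v) →
                      φ (transpose u v x) ≡ transpose (φ u) (φ v) (φ x)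
transpose-conjugate φ {u} {v} {x} inj-u inj-v with transpose u v x | transposeView u v x
... | _ | left          = sym (transpose-matchˡ (φ u) (φ v))
... | _ | right         = sym (transpose-matchʳ (φ u) (φ v))
... | _ | other x≢u x≢v = sym (transpose-mismatch (x≢u ∘ inj-u) (x≢v ∘ inj-v))

-- Removing the last vertex of the lollipop

-- Where a token at x ends up while the token at p travels to the end of the path
-- and that end is removed: the travelling token jumps to the hub h when p < h,
-- which moves the token at the hub to p, and every token it passes on the path
-- steps one vertex back.  The value at x = p is junk.
bypass : ℕ → ℕ → ℕ → ℕ
bypass h p x with <-cmp x (h ⊔ p)
... | tri< _ _ _ = x
... | tri≈ _ _ _ = p
... | tri> _ _ _ = pred x

data BypassView (h p : ℕ) : ℕ → ℕ → Set where
  below : ∀ {x} → x < h ⊔ p → BypassView h p x x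
  at    : ∀ {x} → x ≡ h ⊔ p → BypassView h p x p
  above : ∀ {y} → h ⊔ p ≤ y → BypassView h p (suc y) y

bypassView : ∀ h p x → BypassView h p x (bypass h p x)
bypassView h p x with <-cmp x (h ⊔ p)
... | tri< x<H _ _ = below x<H
... | tri≈ _ x≡H _ = at x≡H
bypassView h p (suc y) | tri> _ _ (s≤s H≤y) = above H≤y

bypass-below : ∀ h p {x} → x < h ⊔ p → bypass h p x ≡ x
bypass-below h p {x} x<H with bypass h p x | bypassView h p x
... | _ | below _   = refl
... | _ | at refl   = contradiction x<H (<-irrefl refl)
... | _ | above H≤y = contradiction (≤-trans (n≤1+n _) x<H) (≤⇒≯ H≤y)

bypass-at : ∀ h p → bypass h p (h ⊔ p) ≡ p
bypass-at h p = go refl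
  where
  go : ∀ {x} → x ≡ h ⊔ p → bypass h p x ≡ p
  go {x} eq with bypass h p x | bypassView h p x
  ... | _ | below x<H = contradiction eq (<⇒≢ x<H)
  ... | _ | at refl   = refl
  ... | _ | above H≤y = contradiction (sym eq) (<⇒≢ (s≤s H≤y))

bypass-above : ∀ h p {y} → h ⊔ p ≤ y → bypass h p (suc y) ≡ y
bypass-above h p {y} H≤y = go refl
  where
  go : ∀ {x} → x ≡ suc y → bypass h p x ≡ y
  go {x} eq with bypass h p x | bypassView h p x
  ... | _ | below x<H = contradiction (≤-trans (≤-reflexive (cong suc (sym eq))) x<H) (≤⇒≯ (≤-trans H≤y (n≤1+n _)))
  ... | _ | at refl   = contradiction eq (<⇒≢ (s≤s H≤y))
  ... | _ | above _   = suc-injective eq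

-- The branches give values below `h ⊔ p`, equal to p, and at least `h ⊔ p`. A clash with the middle
-- one forces an argument equal to p, or `h ⊔ p ≡ p`, where the middle argument itself is p.
bypass-injective : ∀ h p {x y} → x ≢ p → y ≢ p → bypass h p x ≡ bypass h p y → x ≡ y
bypass-injective h p {x} {y} x≢p y≢p eq
  with bypass h p x | bypassView h p x | bypass h p y | bypassView h p y
... | _ | below _   | _ | below _   = eq
... | _ | below _   | _ | at refl   = contradiction eq x≢p
... | _ | below x<H | _ | above H≤y = contradiction eq (<⇒≢ (<-≤-trans x<H H≤y))
... | _ | at refl        | _ | below _   = contradiction (sym eq) y≢p
... | _ | at refl   | _ | at refl   = refl
... | _ | at refl   | _ | above H≤y =
  contradiction (≤-antisym (m≤n⊔m h p) (≤-trans H≤y (≤-reflexive (sym eq)))) (x≢p ∘ sym)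
... | _ | above H≤x | _ | below y<H = contradiction (sym eq) (<⇒≢ (<-≤-trans y<H H≤x))
... | _ | above H≤x | _ | at refl   =
  contradiction (≤-antisym (m≤n⊔m h p) (≤-trans H≤x (≤-reflexive eq))) (y≢p ∘ sym)
... | _ | above _   | _ | above _   = cong suc eq

bypass-< : ∀ {h p k x} → h ≤ k → p ≤ k → x ≤ k → x ≢ p → bypass h p x < k
bypass-< {h} {p} {k} {x} h≤k p≤k x≤k x≢p with bypass h p x | bypassView h p x
... | _ | below x<H = <-≤-trans x<H (⊔-lub h≤k p≤k)
... | _ | at refl   = <-≤-trans (≤∧≢⇒< (m≤n⊔m h p) (x≢p ∘ sym)) x≤k
... | _ | above _   = x≤k

-- The maximum of h and i + 1, in the form in which the RAM computes it.
next : ℕ → ℕ → ℕ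
next h i = suc i + (h ∸ suc i)

next-clique : ∀ {h i} → i < h → next h i ≡ h
next-clique = m+[n∸m]≡n

next-path : ∀ {h i} → h ≤ i → next h i ≡ suc i
next-path {h} {i} h≤i = trans (cong (suc i +_) (m≤n⇒m∸n≡0 (≤-trans h≤i (n≤1+n i)))) (+-identityʳ (suc i))

next-≤ : ∀ {h i k} → h ≤ k → i < k → next h i ≤ k
next-≤ {h} {i} h≤k i<k with <-≤-connex i h
... | inj₁ i<h = ≤-trans (≤-reflexive (next-clique i<h)) h≤k
... | inj₂ h≤i = ≤-trans (≤-reflexive (next-path h≤i)) i<k

-- The first step of the journey from i only moves the token it meets back to i: the hub's token in
-- the clique, the token at i + 1 on the path. The rest of the journey leaves i alone and treats all
-- other tokens as the whole journey does.
bypass-next : ∀ h i {x} → x ≢ i → bypass h (next h i) (transpose i (next h i) x) ≡ bypass h i x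
bypass-next h i {x} x≢i with <-≤-connex i h
... | inj₁ i<h rewrite next-clique i<h with transpose i h x | transposeView i h x
...   | _ | left = contradiction refl x≢i
...   | _ | right = trans (bypass-below h h (<-≤-trans i<h (m≤m⊔n h h)))
                          (sym (trans (cong (bypass h i) (sym (m≥n⇒m⊔n≡m (<⇒≤ i<h)))) (bypass-at h i)))
-- Both thresholds, `h ⊔ i` and `h ⊔ h`, equal h.
...   | _ | other _ x≢h with bypass h i x | bypassView h i x
...     | _ | below x<H = bypass-below h h (subst (_ <_) (trans (m≥n⇒m⊔n≡m (<⇒≤ i<h)) (sym (⊔-idem h))) x<H)
...     | _ | at refl   = contradiction (m≥n⇒m⊔n≡m (<⇒≤ i<h)) x≢h
...     | _ | above H≤y = bypass-above h h (subst (_≤ _) (trans (m≥n⇒m⊔n≡m (<⇒≤ i<h)) (sym (⊔-idem h))) H≤y)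
bypass-next h i {x} x≢i | inj₂ h≤i rewrite next-path h≤i with transpose i (suc i) x | transposeView i (suc i) x
... | _ | left  = contradiction refl x≢i
... | _ | right = trans (bypass-below h (suc i) (m≤n⊔m h (suc i)))
                        (sym (bypass-above h i (⊔-lub h≤i ≤-refl)))
... | _ | other _ x≢1+i with bypass h i x | bypassView h i x
...   | _ | below x<H = bypass-below h (suc i) (<-≤-trans x<H (⊔-monoʳ-≤ h (n≤1+n i)))
...   | _ | at refl   = contradiction (m≤n⇒m⊔n≡n h≤i) x≢i
...   | _ | above H≤y = bypass-above h (suc i)
                          (⊔-lub (≤-trans (m≤m⊔n h i) H≤y)
                                 (≤∧≢⇒< (≤-trans (m≤n⊔m h i) H≤y) (x≢1+i ∘ cong suc ∘ sym)))

-- From a clique vertex the traveller makes room for the hub's token, so the journeys from u and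
-- from v differ only in whether that token lands on u or on v, and the transposition exchanges
-- these. Tokens on the path avoid both.
bypass-clique : ∀ {h u v x} → u < h → v < h → x ≢ u →
                bypass h v (transpose u v x) ≡ transpose u v (bypass h u x)
bypass-clique {h} {u} {v} {x} u<h v<h x≢u with bypass h u x | bypassView h u x
... | _ | at refl = begin
    bypass h v (transpose u v (h ⊔ u)) ≡⟨ cong (bypass h v) (transpose-mismatch (>⇒≢ (subst (u <_) (sym H≡h) u<h)) (>⇒≢ (subst (v <_) (sym H≡h) v<h))) ⟩
    bypass h v (h ⊔ u)                 ≡⟨ cong (bypass h v) (trans H≡h (sym (m≥n⇒m⊔n≡m (<⇒≤ v<h)))) ⟩
    bypass h v (h ⊔ v)                 ≡⟨ bypass-at h v ⟩
    v                                  ≡⟨ transpose-matchˡ u v ⟨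
    transpose u v u                    ∎
  where
  open ≡-Reasoning
  H≡h : h ⊔ u ≡ h
  H≡h = m≥n⇒m⊔n≡m (<⇒≤ u<h)
... | _ | below x<H = bypass-below h v (<-≤-trans (transpose-< u<h v<h (<-≤-trans x<H (⊔-lub ≤-refl (<⇒≤ u<h)))) (m≤m⊔n h v))
... | _ | above {y} H≤y = begin
    bypass h v (transpose u v (suc y)) ≡⟨ cong (bypass h v) (transpose-mismatch x≢u (>⇒≢ (<-trans v<h (s≤s h≤y)))) ⟩
    bypass h v (suc y)                 ≡⟨ bypass-above h v (⊔-lub h≤y (≤-trans (<⇒≤ v<h) h≤y)) ⟩
    y                                  ≡⟨ transpose-mismatch (>⇒≢ (<-≤-trans u<h h≤y)) (>⇒≢ (<-≤-trans v<h h≤y)) ⟨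
    transpose u v y                    ∎
  where
  open ≡-Reasoning
  h≤y : h ≤ y
  h≤y = ≤-trans (m≤m⊔n h u) H≤y

-- Edges of the lollipop and of its initial segments

Link : ℕ → ℕ → ℕ → Set
Link m u v = LAdj m u v ⊎ LAdj m v u

clique-link : ∀ {m u v} → u ≤ m → v ≤ m → u ≢ v → Link m u v
clique-link {u = u} {v} u≤m v≤m u≢v with <-cmp u v
... | tri< u<v _ _ = inj₁ (u<v , inj₁ v≤m)
... | tri≈ _ u≡v _ = contradiction u≡v u≢v
... | tri> _ _ v<u = inj₂ (v<u , inj₁ u≤m)

path-link : ∀ {m u} → m ≤ u → Link m u (suc u)
path-link m≤u = inj₁ (≤-refl , inj₂ (m≤u , refl))

-- The minimum of m and k: the vertices 0, …, k induce a lollipop with this hub.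
hub : ℕ → ℕ → ℕ
hub m k = m ∸ (m ∸ k)

hub≤m : ∀ m k → hub m k ≤ m
hub≤m m k = m∸n≤m m (m ∸ k)

hub-≥ : ∀ {m k} → m ≤ k → hub m k ≡ m
hub-≥ {m} m≤k = cong (m ∸_) (m≤n⇒m∸n≡0 m≤k)

hub-≤ : ∀ {m k} → k ≤ m → hub m k ≡ k
hub-≤ = m∸[m∸n]≡n

hub≤k : ∀ m k → hub m k ≤ k
hub≤k m k with ≤-total m k
... | inj₁ m≤k = ≤-trans (hub≤m m k) m≤k
... | inj₂ k≤m = ≤-reflexive (hub-≤ k≤m)

≤hub : ∀ {m k x} → x ≤ m → x ≤ k → x ≤ hub m k
≤hub {m} {k} x≤m x≤k with ≤-total m k
... | inj₁ m≤k = ≤-trans x≤m (≤-reflexive (sym (hub-≥ m≤k)))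
... | inj₂ k≤m = ≤-trans x≤k (≤-reflexive (sym (hub-≤ k≤m)))

next-link : ∀ {m k i} → i < k → Link m i (next (hub m k) i)
next-link {m} {k} {i} i<k with <-≤-connex i (hub m k)
... | inj₁ i<h rewrite next-clique i<h =
      clique-link (≤-trans (<⇒≤ i<h) (hub≤m m k)) (hub≤m m k) (<⇒≢ i<h)
... | inj₂ h≤i rewrite next-path h≤i = path-link m≤i
  where
  m≤i : m ≤ i
  m≤i with ≤-total m k
  ... | inj₁ m≤k = ≤-trans (≤-reflexive (sym (hub-≥ m≤k))) h≤i
  ... | inj₂ k≤m = contradiction (≤-trans (≤-reflexive (sym (hub-≤ k≤m))) h≤i) (<⇒≱ i<k)

-- Relative to the target k, an edge is a step of a shortest path to k, such a step reversed, or an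
-- edge between clique vertices other than the hub.
data LinkView (h k u v : ℕ) : Set where
  forth  : u < k → v ≡ next h u → LinkView h k u v
  back   : v < k → u ≡ next h v → LinkView h k u v
  inside : u < h → v < h → LinkView h k u v

ladj-view : ∀ {m k u v} → v ≤ k → LAdj m u v → LinkView (hub m k) k u v
ladj-view {m} {k} {u} {v} v≤k (u<v , inj₁ v≤m) with m≤n⇒m<n∨m≡n (≤hub v≤m v≤k)
... | inj₁ v<h = inside (<-trans u<v v<h) v<h
... | inj₂ v≡h = forth (<-≤-trans u<v v≤k) (trans v≡h (sym (next-clique (subst (u <_) v≡h u<v))))
ladj-view {m} {k} v≤k (u<v , inj₂ (m≤u , refl)) =
  forth v≤k (sym (next-path (≤-trans (hub≤m m k) m≤u)))

linkView : ∀ {m k u v} → u ≤ k → v ≤ k → Link m u v → LinkView (hub m k) k u v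
linkView u≤k v≤k (inj₁ uv) = ladj-view v≤k uv
linkView u≤k v≤k (inj₂ vu) with ladj-view u≤k vu
... | forth v<k eq  = back v<k eq
... | back u<k eq   = forth u<k eq
... | inside v<h u<h = inside u<h v<h

-- The delicate edges are those at the hub when p lies before it: the hub becomes p and the first
-- path vertex becomes the hub, but p and the hub are both in the clique. Other path edges avoiding
-- p stay or shift as a whole.
bypass-ladj : ∀ {m k p u v} → v ≤ k → u ≢ p → v ≢ p → LAdj m u v →
              Link m (bypass (hub m k) p u) (bypass (hub m k) p v)
bypass-ladj {m} {k} {p} {u} {v} v≤k u≢p v≢p (u<v , inj₁ v≤m)
  rewrite bypass-below (hub m k) p (<-≤-trans u<v (≤-trans (≤hub v≤m v≤k) (m≤m⊔n (hub m k) p)))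
  with bypass (hub m k) p v | bypassView (hub m k) p v
... | _ | below _   = inj₁ (u<v , inj₁ v≤m)
... | _ | at refl   = clique-link (≤-trans (<⇒≤ u<v) v≤m) (≤-trans (m≤n⊔m (hub m k) p) v≤m) u≢p
... | _ | above H≤y = contradiction (≤-trans (≤hub v≤m v≤k) (≤-trans (m≤m⊔n (hub m k) p) H≤y)) 1+n≰n
bypass-ladj {m} {k} {p} {u} v≤k u≢p v≢p (_ , inj₂ (m≤u , refl))
  with bypass (hub m k) p u | bypassView (hub m k) p u
... | _ | at refl rewrite bypass-above (hub m k) p {hub m k ⊔ p} ≤-refl with ⊔-sel (hub m k) p
...   | inj₁ H≡h = clique-link (≤-trans (m≤n⊔m (hub m k) p) H≤m) H≤m (u≢p ∘ sym)
  where
  H≤m : hub m k ⊔ p ≤ m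
  H≤m = ≤-trans (≤-reflexive H≡h) (hub≤m m k)
...   | inj₂ H≡p = contradiction H≡p u≢p
bypass-ladj {m} {k} {p} {u} v≤k u≢p v≢p (_ , inj₂ (m≤u , refl)) | _ | below u<H
  with bypass (hub m k) p (suc u) | bypassView (hub m k) p (suc u)
... | _ | below _   = path-link m≤u
... | _ | above H≤u = contradiction u<H (≤⇒≯ H≤u)
... | _ | at 1+u≡H with ⊔-sel (hub m k) p
...   | inj₁ H≡h = contradiction (≤-trans (≤-reflexive (trans 1+u≡H H≡h)) (≤-trans (hub≤m m k) m≤u)) 1+n≰n
...   | inj₂ H≡p = contradiction (trans 1+u≡H H≡p) v≢p
bypass-ladj {m} {k} {p} {suc y} v≤k u≢p v≢p (_ , inj₂ (m≤u , refl)) | _ | above H≤y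
  rewrite bypass-above (hub m k) p (≤-trans H≤y (n≤1+n y)) = path-link m≤y
  where
  m≤y : m ≤ y
  m≤y = ≤-trans (≤-reflexive (sym (hub-≥ (≤-trans m≤u (≤-trans (n≤1+n _) v≤k)))))
                (≤-trans (m≤m⊔n (hub m k) p) H≤y)

bypass-link : ∀ {m k p u v} → u ≤ k → v ≤ k → u ≢ p → v ≢ p → Link m u v →
              Link m (bypass (hub m k) p u) (bypass (hub m k) p v)
bypass-link u≤k v≤k u≢p v≢p (inj₁ uv) = bypass-ladj v≤k u≢p v≢p uv
bypass-link u≤k v≤k u≢p v≢p (inj₂ vu) = Sum.swap (bypass-ladj u≤k v≢p u≢p vu)

-- Position maps

-- Position maps are functions on all of ℕ, constrained only below N, so that removing the last
-- vertex changes N but not the type.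
record Embeds (N : ℕ) (q : ℕ → ℕ) : Set where
  field
    bounded   : ∀ {t} → t < N → q t < N
    injective : ∀ {t t′} → t < N → t′ < N → q t ≡ q t′ → t ≡ t′
open Embeds

transpose-embeds : ∀ {N q u v} → u < N → v < N → Embeds N q → Embeds N (transpose u v ∘ q)
transpose-embeds {u = u} {v} u<N v<N emb = record
  { bounded   = λ t<N → transpose-< u<N v<N (bounded emb t<N)
  ; injective = λ t<N t′<N eq → injective emb t<N t′<N (transpose-injective u v eq)
  }

embeds-cong : ∀ {N q q′} → (∀ {t} → t < N → q′ t ≡ q t) → Embeds N q → Embeds N q′
embeds-cong eq emb = record
  { bounded   = λ t<N → subst (_< _) (sym (eq t<N)) (bounded emb t<N)
  ; injective = λ t<N t′<N e → injective emb t<N t′<N (trans (sym (eq t<N)) (trans e (eq t′<N)))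
  }

avoids-top : ∀ {k q t} → Embeds (suc k) q → t < k → q t ≢ q k
avoids-top emb t<k eq = <⇒≢ t<k (injective emb (m<n⇒m<1+n t<k) ≤-refl eq)

bypass-embeds : ∀ m {k q} → Embeds (suc k) q → Embeds k (bypass (hub m k) (q k) ∘ q)
bypass-embeds m {k} {q} emb = record
  { bounded   = λ t<k → bypass-< (hub≤k m k) (s≤s⁻¹ (bounded emb ≤-refl))
                                 (s≤s⁻¹ (bounded emb (m<n⇒m<1+n t<k))) (avoids-top emb t<k)
  ; injective = λ t<k t′<k eq → injective emb (m<n⇒m<1+n t<k) (m<n⇒m<1+n t′<k)
      (bypass-injective (hub m k) (q k) (avoids-top emb t<k) (avoids-top emb t′<k) eq)
  }

-- The cost of recursive sorting and its change under swaps

dist : ℕ → ℕ → ℕ → ℕ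
dist h k p with p <? h
... | yes _ = suc (k ∸ h)
... | no _  = k ∸ p

dist-clique : ∀ {h k p} → p < h → dist h k p ≡ suc (k ∸ h)
dist-clique {h} {p = p} p<h with p <? h
... | yes _  = refl
... | no p≮h = contradiction p<h p≮h

dist-path : ∀ {h k p} → h ≤ p → dist h k p ≡ k ∸ p
dist-path {h} {p = p} h≤p with p <? h
... | yes p<h = contradiction p<h (≤⇒≯ h≤p)
... | no _    = refl

dist-next : ∀ {h k i} → i < k → dist h k i ≡ suc (dist h k (next h i))
dist-next {h} {k} {i} i<k with <-≤-connex i h
... | inj₁ i<h rewrite next-clique i<h | dist-path {h} {k} {h} ≤-refl = dist-clique i<h
... | inj₂ h≤i rewrite next-path h≤i | dist-path {h} {k} (≤-trans h≤i (n≤1+n i)) =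
      trans (dist-path h≤i) (sym (suc-pred-∸ i<k))
  where
  suc-pred-∸ : ∀ {i k} → i < k → suc (k ∸ suc i) ≡ k ∸ i
  suc-pred-∸ (s≤s i≤k) = sym (+-∸-assoc 1 i≤k)

dist-goal : ∀ {h k} → h ≤ k → dist h k k ≡ 0
dist-goal {h} {k} h≤k = trans (dist-path h≤k) (n∸n≡0 k)

-- q t is the vertex holding token t; only the tokens and vertices below k remain.
cost : ℕ → ℕ → (ℕ → ℕ) → ℕ
cost m zero    q = 0
cost m (suc k) q = dist (hub m k) k (q k) + cost m k (bypass (hub m k) (q k) ∘ q)

cost-cong : ∀ m k {q q′} → (∀ {t} → t < k → q t ≡ q′ t) → cost m k q ≡ cost m k q′
cost-cong m zero    eq = refl
cost-cong m (suc k) eq rewrite eq {k} ≤-refl =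
  cong (dist (hub m k) k _ +_) (cost-cong m k (λ t<k → cong (bypass (hub m k) _) (eq (m<n⇒m<1+n t<k))))

cost-step : ∀ m k {q q′ p} → q k ≡ p → (∀ {t} → t < k → q′ t ≡ bypass (hub m k) p (q t)) →
            cost m (suc k) q ≡ dist (hub m k) k p + cost m k q′
cost-step m k refl eq = cong (dist (hub m k) k _ +_) (cost-cong m k (sym ∘ eq))

-- By `dist-next` the step shortens the journey of token k by one, and by `bypass-next` the
-- configuration after the journey is the same.
cost-advance : ∀ m {k q q′ i} → Embeds (suc k) q → q k ≡ i → i < k →
               (∀ {t} → t < suc k → q′ t ≡ transpose i (next (hub m k) i) (q t)) →
               cost m (suc k) q ≡ suc (cost m (suc k) q′)
cost-advance m {k} {q} {q′} emb refl i<k swapped = begin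
  cost m (suc k) q
    ≡⟨ cong (_+ cost m k (bypass h (q k) ∘ q)) (dist-next {h} i<k) ⟩
  suc (dist h k j + cost m k (bypass h (q k) ∘ q))
    ≡⟨ cong suc (cost-step m k {q′} q′k≡j same) ⟨
  suc (cost m (suc k) q′) ∎
  where
  open ≡-Reasoning
  h = hub m k
  j = next h (q k)
  q′k≡j : q′ k ≡ j
  q′k≡j = trans (swapped ≤-refl) (transpose-matchˡ (q k) j)
  same : ∀ {t} → t < k → bypass h (q k) (q t) ≡ bypass h j (q′ t)
  same t<k = trans (sym (bypass-next h (q k) (avoids-top emb t<k)))
                   (cong (bypass h j) (sym (swapped (m<n⇒m<1+n t<k))))

unswap : ∀ {N u v} {q q′ : ℕ → ℕ} → (∀ {t} → t < N → q′ t ≡ transpose u v (q t)) →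
         ∀ {t} → t < N → q t ≡ transpose u v (q′ t)
unswap {u = u} {v} {q} swapped {t} t<N =
  trans (sym (transpose-involutive u v (q t))) (cong (transpose u v) (sym (swapped t<N)))

reverse : ∀ {N u v} {q q′ : ℕ → ℕ} → (∀ {t} → t < N → q′ t ≡ transpose u v (q t)) →
         ∀ {t} → t < N → q′ t ≡ transpose v u (q t)
reverse {u = u} {v} {q} swapped {t} t<N = trans (swapped t<N) (transpose-comm u v (q t))

mutual
  -- The split is on whether token k occupies u, v or neither. The second case is the first with the
  -- edge reversed; in the third, `bypass` conjugates the swap into one along an edge of the smaller
  -- lollipop.
  cost-lipschitz : ∀ m k {q q′ u v} → Embeds k q → u < k → v < k → Link m u v →
                   (∀ {t} → t < k → q′ t ≡ transpose u v (q t)) → cost m k q ≤ suc (cost m k q′)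
  cost-lipschitz m (suc k) {q} {q′} {u} {v} emb u<1+k v<1+k uv swapped with q k ≟ u | q k ≟ v
  ... | yes p≡u | _ = cost-lipschitz-at m k emb u<1+k v<1+k uv p≡u swapped
  ... | no _ | yes p≡v =
        cost-lipschitz-at m k emb v<1+k u<1+k (Sum.swap uv) p≡v (reverse {q = q} {q′} swapped)
  ... | no p≢u | no p≢v = begin
    cost m (suc k) q                      ≡⟨⟩
    dist h k p + cost m k (φ ∘ q)         ≤⟨ +-monoʳ-≤ (dist h k p) ih ⟩
    dist h k p + suc (cost m k (φ ∘ q′))  ≡⟨ +-suc (dist h k p) _ ⟩
    suc (dist h k p + cost m k (φ ∘ q′))  ≡⟨ cong suc (cost-step m k {q′} q′k≡p (λ _ → refl)) ⟨
    suc (cost m (suc k) q′)               ∎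
    where
    open ≤-Reasoning
    h = hub m k
    p = q k
    φ = bypass h p
    p≤k = s≤s⁻¹ (bounded emb ≤-refl)
    u≤k = s≤s⁻¹ u<1+k
    v≤k = s≤s⁻¹ v<1+k
    q′k≡p : q′ k ≡ p
    q′k≡p = trans (swapped ≤-refl) (transpose-mismatch p≢u p≢v)
    conjugated : ∀ {t} → t < k → φ (q′ t) ≡ transpose (φ u) (φ v) (φ (q t))
    conjugated t<k = trans (cong φ (swapped (m<n⇒m<1+n t<k)))
      (transpose-conjugate φ (bypass-injective h p (avoids-top emb t<k) (p≢u ∘ sym))
                             (bypass-injective h p (avoids-top emb t<k) (p≢v ∘ sym)))
    ih : cost m k (φ ∘ q) ≤ suc (cost m k (φ ∘ q′))
    ih = cost-lipschitz m k (bypass-embeds m emb)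
           (bypass-< (hub≤k m k) p≤k u≤k (p≢u ∘ sym)) (bypass-< (hub≤k m k) p≤k v≤k (p≢v ∘ sym))
           (bypass-link u≤k v≤k (p≢u ∘ sym) (p≢v ∘ sym) uv) conjugated

  cost-lipschitz-at : ∀ m k {q q′ u v} → Embeds (suc k) q → u < suc k → v < suc k → Link m u v → q k ≡ u →
                      (∀ {t} → t < suc k → q′ t ≡ transpose u v (q t)) →
                      cost m (suc k) q ≤ suc (cost m (suc k) q′)
  cost-lipschitz-at m k {q} {q′} {u} {v} emb u<1+k v<1+k uv refl swapped
    with linkView (s≤s⁻¹ u<1+k) (s≤s⁻¹ v<1+k) uv
  ... | forth u<k refl = ≤-reflexive (cost-advance m emb refl u<k swapped)
  -- Undoing the swap advances token k, so `q′` costs one more than `q`, and the claim holds with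
  -- slack two.
  ... | back v<k u≡j = ≤-trans (n≤1+n _) (≤-trans (≤-reflexive (sym back-step)) (n≤1+n _))
    where
    q′k≡v : q′ k ≡ v
    q′k≡v = trans (swapped ≤-refl) (transpose-matchˡ u v)
    back-step : cost m (suc k) q′ ≡ suc (cost m (suc k) q)
    back-step = cost-advance m (embeds-cong swapped (transpose-embeds u<1+k v<1+k emb)) q′k≡v v<k
      (λ {t} t<1+k → subst (λ j → q t ≡ transpose v j (q′ t)) u≡j
        (reverse {q = q′} {q} (unswap {q = q} {q′} swapped) t<1+k))
  ... | inside u<h v<h = begin
    cost m (suc k) q                              ≡⟨⟩
    dist h k u + cost m k (bypass h u ∘ q)        ≤⟨ +-monoʳ-≤ (dist h k u) ih ⟩
    dist h k u + suc (cost m k (bypass h v ∘ q′)) ≡⟨ +-suc (dist h k u) _ ⟩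
    suc (dist h k u + cost m k (bypass h v ∘ q′)) ≡⟨ cong (λ d → suc (d + cost m k (bypass h v ∘ q′))) (trans (dist-clique u<h) (sym (dist-clique v<h))) ⟩
    suc (dist h k v + cost m k (bypass h v ∘ q′)) ≡⟨ cong suc (cost-step m k {q′} q′k≡v (λ _ → refl)) ⟨
    suc (cost m (suc k) q′)                       ∎
    where
    open ≤-Reasoning
    h = hub m k
    q′k≡v : q′ k ≡ v
    q′k≡v = trans (swapped ≤-refl) (transpose-matchˡ u v)
    conjugated : ∀ {t} → t < k → bypass h v (q′ t) ≡ transpose u v (bypass h u (q t))
    conjugated t<k = trans (cong (bypass h v) (swapped (m<n⇒m<1+n t<k)))
                           (bypass-clique u<h v<h (avoids-top emb t<k))
    ih : cost m k (bypass h u ∘ q) ≤ suc (cost m k (bypass h v ∘ q′))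
    -- Here u and v keep their labels, so the same edge serves the smaller lollipop.
    ih = cost-lipschitz m k (bypass-embeds m emb) (<-≤-trans u<h (hub≤k m k)) (<-≤-trans v<h (hub≤k m k))
           uv conjugated

-- At home, token k has distance zero, and every other token lies below k, the threshold of
-- `bypass`, so nothing moves.
cost-goal : ∀ m k {q} → Embeds (suc k) q → q k ≡ k → cost m (suc k) q ≡ cost m k q
cost-goal m k {q} emb qk≡k = trans (cost-step m k {q} {q} qk≡k (λ t<k → sym (bypass-below (hub m k) k (below-top t<k))))
                               (cong (_+ cost m k q) (dist-goal (hub≤k m k)))
  where
  below-top : ∀ {t} → t < k → q t < hub m k ⊔ k
  below-top t<k = <-≤-trans (≤∧≢⇒< (s≤s⁻¹ (bounded emb (m<n⇒m<1+n t<k)))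
                                   (λ e → avoids-top emb t<k (trans e (sym qk≡k))))
                            (m≤n⊔m (hub m k) k)

fixing-top-embeds : ∀ {k q} → Embeds (suc k) q → q k ≡ k → Embeds k q
fixing-top-embeds emb qk≡k = record
  { bounded   = λ t<k → ≤∧≢⇒< (s≤s⁻¹ (bounded emb (m<n⇒m<1+n t<k))) (λ e → avoids-top emb t<k (trans e (sym qk≡k)))
  ; injective = λ t<k t′<k → injective emb (m<n⇒m<1+n t<k) (m<n⇒m<1+n t′<k)
  }

cost-identity : ∀ m k {q} → Embeds k q → (∀ {t} → t < k → q t ≡ t) → cost m k q ≡ 0
cost-identity m zero    emb fixed = refl
cost-identity m (suc k) emb fixed =
  trans (cost-goal m k emb (fixed ≤-refl))
        (cost-identity m k (fixing-top-embeds emb (fixed ≤-refl)) (fixed ∘ m<n⇒m<1+n))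

-- Cost-reducing swaps

data Descent (m N : ℕ) (q : ℕ → ℕ) : Set where
  done : cost m N q ≡ 0 → (∀ {t} → t < N → q t ≡ t) → Descent m N q
  step : ∀ {u v} → u < N → v < N → Link m u v →
         cost m N q ≡ suc (cost m N (transpose u v ∘ q)) → Descent m N q

-- Either token k has a step of its shortest path left to make, or it is home and `cost-goal` lifts
-- the answer found without vertex k.
descent : ∀ m N {q} → Embeds N q → Descent m N q
descent m zero    emb = done refl (λ ())
descent m (suc k) {q} emb with m≤n⇒m<n∨m≡n (s≤s⁻¹ (bounded emb (n<1+n k)))
... | inj₁ p<k = step (bounded emb ≤-refl) (s≤s (next-≤ (hub≤k m k) p<k)) (next-link p<k)
                      (cost-advance m emb refl p<k (λ _ → refl))
... | inj₂ p≡k with descent m k (fixing-top-embeds emb p≡k)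
...   | done c≡0 fixed = done (trans (cost-goal m k emb p≡k) c≡0) fixed′
  where
  fixed′ : ∀ {t} → t < suc k → q t ≡ t
  fixed′ t<1+k with m<1+n⇒m<n∨m≡n t<1+k
  ... | inj₁ t<k  = fixed t<k
  ... | inj₂ refl = p≡k
-- The swap avoids k, so token k stays home and `cost-goal` applies to both sides.
...   | step {u} {v} u<k v<k uv eq = step (m<n⇒m<1+n u<k) (m<n⇒m<1+n v<k) uv
  (trans (cost-goal m k emb p≡k) (trans eq (cong suc (sym
    (cost-goal m k (transpose-embeds (m<n⇒m<1+n u<k) (m<n⇒m<1+n v<k) emb) fixed-top)))))
  where
  fixed-top : transpose u v (q k) ≡ k
  fixed-top = trans (cong (transpose u v) p≡k) (transpose-mismatch (<⇒≢ u<k ∘ sym) (<⇒≢ v<k ∘ sym))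

-- The cost is the minimum number of swaps

-- `f` gives tokens by vertex and `q` vertices by token. A swap of two vertices then composes `q`
-- with a transposition on the outside, the form treated above.
Positions : ∀ m n → Config m n → (ℕ → ℕ) → Set
Positions m n f q = ∀ v → q (toℕ (f v)) ≡ toℕ v

swap-positions : ∀ {m n f q} (e : Edge m n) → Positions m n f q →
                 Positions m n (swap f e) (transpose (toℕ (Edge.u e)) (toℕ (Edge.v e)) ∘ q)
swap-positions (edge u v _) pos w with w Fin.≟ u
... | yes refl = trans (cong (transpose _ _) (pos v)) (transpose-matchʳ (toℕ u) (toℕ v))
... | no w≢u with w Fin.≟ v
...   | yes refl = trans (cong (transpose _ _) (pos u)) (transpose-matchˡ (toℕ u) (toℕ v))
...   | no w≢v   = trans (cong (transpose _ _) (pos w))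
                         (transpose-mismatch (w≢u ∘ Fin.toℕ-injective) (w≢v ∘ Fin.toℕ-injective))

-- The recursion is on the value c, tied to the cost by an equation, because `f` and `q` both change
-- along the descent.
cost-achieved : ∀ m n c {f q} → Embeds (suc (m + n)) q → Positions m n f q → cost m (suc (m + n)) q ≡ c →
                Σ (List (Edge m n)) (λ es → length es ≡ c × IsIdentity m n (applySeq f es))
cost-achieved m n c {f} {q} emb pos eq with descent m (suc (m + n)) emb
cost-achieved m n c {f} {q} emb pos eq | done c≡0 fixed =
  [] , trans (sym c≡0) eq , λ v → Fin.toℕ-injective (trans (sym (fixed (Fin.toℕ<n (f v)))) (pos v))
cost-achieved m n zero emb pos eq | step _ _ _ c≡1+c′ = contradiction (trans (sym c≡1+c′) eq) 1+n≢0
cost-achieved m n (suc c) {f} {q} emb pos eq | step {u} {v} u<N v<N uv c≡1+c′ =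
  let es , len , id = cost-achieved m n c (transpose-embeds u<N v<N emb) pos′
                        (suc-injective (trans (sym c≡1+c′) eq))
  in e ∷ es , cong suc len , id
  where
  e : Edge m n
  e = edge (fromℕ< u<N) (fromℕ< v<N)
           (subst₂ (Link m) (sym (Fin.toℕ-fromℕ< u<N)) (sym (Fin.toℕ-fromℕ< v<N)) uv)
  pos′ : Positions m n (swap f e) (transpose u v ∘ q)
  pos′ = subst₂ (λ x y → Positions m n (swap f e) (transpose x y ∘ q))
                (Fin.toℕ-fromℕ< u<N) (Fin.toℕ-fromℕ< v<N) (swap-positions {f = f} {q} e pos)

-- The cost vanishes at the identity and drops by at most one per swap.
cost-minimal : ∀ m n es {f q} → Embeds (suc (m + n)) q → Positions m n f q →
               IsIdentity m n (applySeq f es) → cost m (suc (m + n)) q ≤ length es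
cost-minimal m n [] {f} {q} emb pos id = ≤-reflexive (cost-identity m (suc (m + n)) emb fixed)
  where
  fixed : ∀ {t} → t < suc (m + n) → q t ≡ t
  fixed t<N = subst (λ t → q t ≡ t) (Fin.toℕ-fromℕ< t<N)
                (trans (cong (q ∘ toℕ) (sym (id (fromℕ< t<N)))) (pos (fromℕ< t<N)))
cost-minimal m n (e@(edge u v uv) ∷ es) {f} {q} emb pos id =
  ≤-trans (cost-lipschitz m (suc (m + n)) emb (Fin.toℕ<n u) (Fin.toℕ<n v) uv (λ _ → refl))
          (s≤s (cost-minimal m n es (transpose-embeds (Fin.toℕ<n u) (Fin.toℕ<n v) emb)
                             (swap-positions {f = f} {q} e pos) id))

cost-isTS : ∀ m n {f q} → Embeds (suc (m + n)) q → Positions m n f q → IsTS m n f (cost m (suc (m + n)) q)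
cost-isTS m n emb pos = cost-achieved m n _ emb pos refl , λ es → cost-minimal m n es emb pos

-- The token array and its inverse

-- The machine stores only the array `g` of tokens by vertex; the positions `q`, from which the cost
-- is defined, exist in the proof alone.
record Inverse (N : ℕ) (g q : ℕ → ℕ) : Set where
  field
    embeds   : Embeds N q
    g-bound  : ∀ {i} → i < N → g i < N
    q∘g      : ∀ {i} → i < N → q (g i) ≡ i
    g∘q      : ∀ {t} → t < N → g (q t) ≡ t
open Inverse

module _ {m n : ℕ} (f : Config m n) (bij : Bijective _≡_ _≡_ f) where

  private
    preimage : Vertex m n → Vertex m n
    preimage y = proj₁ (proj₂ bij y)

    f-preimage : ∀ y → f (preimage y) ≡ y
    f-preimage y = proj₂ (proj₂ bij y) refl

  position : ℕ → ℕ
  position t with t <? suc (m + n)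
  ... | yes t<N = toℕ (preimage (fromℕ< t<N))
  ... | no _    = t

  position-toℕ : ∀ y → position (toℕ y) ≡ toℕ (preimage y)
  position-toℕ y with toℕ y <? suc (m + n)
  ... | yes y<N = cong (toℕ ∘ preimage) (Fin.fromℕ<-toℕ y y<N)
  ... | no y≮N  = contradiction (Fin.toℕ<n y) y≮N

  position-positions : Positions m n f position
  position-positions v = trans (position-toℕ (f v)) (cong toℕ (proj₁ bij (f-preimage (f v))))

  position-inverse : ∀ {g} → (∀ v → g (toℕ v) ≡ toℕ (f v)) → Inverse (suc (m + n)) g position
  position-inverse {g} array = record
    { embeds = record
      { bounded   = λ t<N → every (λ t → position t < suc (m + n))
                      (λ y → subst (_< suc (m + n)) (sym (position-toℕ y)) (Fin.toℕ<n (preimage y))) t<N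
      ; injective = λ t<N t′<N eq → trans (sym (g∘q′ t<N)) (trans (cong g eq) (g∘q′ t′<N))
      }
    ; g-bound = every (λ i → g i < suc (m + n)) (λ v → subst (_< suc (m + n)) (sym (array v)) (Fin.toℕ<n (f v)))
    ; q∘g = every (λ i → position (g i) ≡ i) (λ v → trans (cong position (array v)) (position-positions v))
    ; g∘q = g∘q′
    }
    where
    every : (P : ℕ → Set) → (∀ (v : Vertex m n) → P (toℕ v)) → ∀ {t} → t < suc (m + n) → P t
    every P all t<N = subst P (Fin.toℕ-fromℕ< t<N) (all (fromℕ< t<N))
    g∘q′ : ∀ {t} → t < suc (m + n) → g (position t) ≡ t
    g∘q′ = every (λ t → g (position t) ≡ t)
             (λ y → trans (cong g (position-toℕ y)) (trans (array (preimage y)) (cong toℕ (f-preimage y))))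

-- Reading the input array

-- The encoder local to `inputMem` has no name outside Defs.  Once `m + n` and
-- the function it encodes have been abstracted, checking `encode-input` solves
-- the metavariable in `encode` to be that encoder, for all N and p.  The family
-- P, the function `finish` and the argument of `q` keep the abstraction
-- well-typed; they are instantiated away in `encoder`.
module _ (m n : ℕ) (P : ℕ → Set) (finish : ∀ N → P N → Fin N → Vertex m n) (q : ⊤ → P (m + n)) where

  private
    config : Config m n
    config Fin.zero    = Fin.zero
    config (Fin.suc v) = finish (m + n) (q tt) v

  mutual
    encode : ∀ N → P N → ℕ → ℕ
    encode N p i = _

    encode-input : ∀ i → inputMem m n config (3 + i) ≡ encode (m + n) (q tt) i
    encode-input i with m + n | q tt
    ... | N | p = refl

encoder : ∀ m n N → (Fin N → Vertex m n) → ℕ → ℕ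
encoder m n = encode m n (λ N → Fin N → Vertex m n) (λ _ g → g) (λ _ _ → Fin.zero)

encoder-toℕ : ∀ m n {N} (g : Fin N → Vertex m n) v → encoder m n N g (toℕ v) ≡ toℕ (g v)
encoder-toℕ m n g Fin.zero    = refl
encoder-toℕ m n g (Fin.suc v) = encoder-toℕ m n (g ∘ Fin.suc) v

inputMem-toℕ : ∀ m n f (v : Vertex m n) → inputMem m n f (2 + toℕ v) ≡ toℕ (f v)
inputMem-toℕ m n f = encoder-toℕ m n f

-- Memory updates and register lists

update-≡ : ∀ m a {x v} → x ≡ a → update m a v x ≡ v
update-≡ m a {x} x≡a with x ≡ᵇ a | ≡⇒≡ᵇ x a x≡a
... | true | _ = refl

update-≢ : ∀ m a {x v} → x ≢ a → update m a v x ≡ m x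
update-≢ m a {x} x≢a with x ≡ᵇ a | ≡ᵇ⇒≡ x a
... | true  | eq = contradiction (eq tt) x≢a
... | false | _  = refl

get : List ℕ → ℕ → ℕ
get []      _       = 0
get (x ∷ _) zero    = x
get (_ ∷ ρ) (suc r) = get ρ r

set : List ℕ → ℕ → ℕ → List ℕ
set []      _       _ = []
set (_ ∷ ρ) zero    v = v ∷ ρ
set (x ∷ ρ) (suc r) v = x ∷ set ρ r v

length-set : ∀ ρ r v → length (set ρ r v) ≡ length ρ
length-set []      _       _ = refl
length-set (_ ∷ ρ) zero    _ = refl
length-set (_ ∷ ρ) (suc r) v = cong suc (length-set ρ r v)

get-set : ∀ ρ r v → r < length ρ → get (set ρ r v) r ≡ v
get-set (_ ∷ ρ) zero    v _         = refl
get-set (_ ∷ ρ) (suc r) v (s≤s r<l) = get-set ρ r v r<l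

get-set-≢ : ∀ ρ r v {x} → x ≢ r → get (set ρ r v) x ≡ get ρ x
get-set-≢ []      r       v         _   = refl
get-set-≢ (_ ∷ ρ) zero    v {zero}  x≢r = contradiction refl x≢r
get-set-≢ (_ ∷ ρ) zero    v {suc x} _   = refl
get-set-≢ (_ ∷ ρ) (suc r) v {zero}  _   = refl
get-set-≢ (_ ∷ ρ) (suc r) v {suc x} x≢r = get-set-≢ ρ r v (x≢r ∘ cong suc)

-- Symbolic execution of RAM programs

-- In concrete runs the register list has a literal spine, so `get` and `set` at literal numbers
-- compute and successor configurations are found by unification.
record Conf : Set where
  constructor conf
  field
    ip   : ℕ
    regs : List ℕ
    heap : ℕ → ℕ

-- Each of these mentions its Conf only once, so that the configurations inferred
-- along a chain of steps do not grow exponentially.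
assign : ℕ → (List ℕ → ℕ) → Conf → Conf
assign r e (conf p ρ g) = conf (suc p) (set ρ r (e ρ)) g

write : ℕ → ℕ → Conf → Conf
write i r (conf p ρ g) = conf (suc p) ρ (update g i (get ρ r))

goto : ℕ → Conf → Conf
goto l (conf _ ρ g) = conf l ρ g

skip : Conf → Conf
skip (conf p ρ g) = conf (suc p) ρ g

-- Registers below length ρ hold ρ and the memory from address B on holds g; the
-- registers in between are unconstrained.
record Represents (B : ℕ) (ρ : List ℕ) (g M : ℕ → ℕ) : Set where
  field
    low  : ∀ {r} → r < length ρ → M r ≡ get ρ r
    high : ∀ i → M (B + i) ≡ g i
    gap  : length ρ ≤ B
open Represents

represents-set : ∀ {B ρ g M} r {v w} → r < length ρ → w ≡ v → Represents B ρ g M →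
                 Represents B (set ρ r v) g (update M r w)
represents-set {B} {ρ} {g} {M} r {v} {w} r<l refl rep = record
  { low  = low′
  ; high = λ i → trans (update-≢ M r (>⇒≢ (<-≤-trans r<l (≤-trans (gap rep) (m≤m+n B i))))) (high rep i)
  ; gap  = subst (_≤ B) (sym (length-set ρ r v)) (gap rep)
  }
  where
  low′ : ∀ {x} → x < length (set ρ r v) → update M r v x ≡ get (set ρ r v) x
  low′ {x} x<l with x ≟ r
  ... | yes refl = trans (update-≡ M r refl) (sym (get-set ρ r v r<l))
  ... | no x≢r   = trans (update-≢ M r x≢r)
                         (trans (low rep (subst (x <_) (length-set ρ r v) x<l)) (sym (get-set-≢ ρ r v x≢r)))

represents-store : ∀ {B ρ g M} i {a v w} → a ≡ B + i → w ≡ v → Represents B ρ g M →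
                   Represents B ρ (update g i v) (update M a w)
represents-store {B} {ρ} {g} {M} i {v = v} refl refl rep = record
  { low  = λ r<l → trans (update-≢ M (B + i) (<⇒≢ (<-≤-trans r<l (≤-trans (gap rep) (m≤m+n B i))))) (low rep r<l)
  ; high = high′
  ; gap  = gap rep
  }
  where
  high′ : ∀ x → update M (B + i) v (B + x) ≡ update g i v x
  high′ x with x ≟ i
  ... | yes refl = trans (update-≡ M (B + i) refl) (sym (update-≡ g i refl))
  ... | no x≢i   = trans (update-≢ M (B + i) (x≢i ∘ +-cancelˡ-≡ B x i)) (trans (high rep x) (sym (update-≢ g i x≢i)))

run-fetch : ∀ P {i p M} j → fetch P p ≡ just i → run P (suc j) (st p M) ≡ run P j (exec i (st p M))
run-fetch P {p = p} j eq with fetch P p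
run-fetch P j refl | just _ = refl

run-halted : ∀ P {p M} j → fetch P p ≡ nothing → run P j (st p M) ≡ just (st p M)
run-halted P {p} j eq with fetch P p
... | nothing = refl

module Simulation (P : Program) (B : ℕ) where

  -- The equation for every leftover fuel j makes runs composable. As b only bounds the number of
  -- steps, branches of different lengths can share it.
  record Reach (b : ℕ) (s s′ : Conf) : Set where
    field
      simulate : ∀ {M} → Represents B (Conf.regs s) (Conf.heap s) M →
                 Σ ℕ λ t → Σ (ℕ → ℕ) λ M′ → t ≤ b × Represents B (Conf.regs s′) (Conf.heap s′) M′ ×
                 (∀ j → run P (t + j) (st (Conf.ip s) M) ≡ run P j (st (Conf.ip s′) M′))
  open Reach public

  infixr 6 _⨾_

  _⨾_ : ∀ {b b′ s s′ s″} → Reach b s s′ → Reach b′ s′ s″ → Reach (b + b′) s s″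
  simulate (_⨾_ {s = s} x y) {M} rep =
    let t  , _  , t≤b   , rep₁ , run₁ = simulate x rep
        t′ , M″ , t′≤b′ , rep₂ , run₂ = simulate y rep₁
    in t + t′ , M″ , +-mono-≤ t≤b t′≤b′ , rep₂ ,
       λ j → trans (cong (λ u → run P u (st (Conf.ip s) M)) (+-assoc t t′ j)) (trans (run₁ (t′ + j)) (run₂ j))

  infixr 4 _⇒⟨_⟩_

  _⇒⟨_⟩_ : ∀ s {b b′ s′ s″} → Reach b s s′ → Reach b′ s′ s″ → Reach (b + b′) s s″
  _ ⇒⟨ x ⟩ y = x ⨾ y

  infix 5 _⇒⟨_⟩■

  _⇒⟨_⟩■ : ∀ s {b s′} → Reach b s s′ → Reach b s s′
  _ ⇒⟨ x ⟩■ = x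

  weaken : ∀ {b b′ s s′} → b ≤ b′ → Reach b s s′ → Reach b′ s s′
  simulate (weaken b≤b′ x) rep =
    let t , M′ , t≤b , rest = simulate x rep in t , M′ , ≤-trans t≤b b≤b′ , rest

  private
    single : ∀ {p p′ M M′ ρ′ g′} i → fetch P p ≡ just i → exec i (st p M) ≡ st p′ M′ → Represents B ρ′ g′ M′ →
             Σ ℕ λ t → Σ (ℕ → ℕ) λ M′ → t ≤ 1 × Represents B ρ′ g′ M′ ×
             (∀ j → run P (t + j) (st p M) ≡ run P j (st p′ M′))
    single {M′ = M′} i f ex rep =
      1 , M′ , ≤-refl , rep , λ j → trans (run-fetch P j f) (cong (run P j) ex)

  module _ {s : Conf} where
    open Conf s renaming (ip to p; regs to ρ; heap to g)

    -- For literal registers `T (r <ᵇ length ρ)` reduces to the unit type, so the bounds here and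
    -- below are filled in silently.
    const! : ∀ {r k} → fetch P p ≡ just (const r k) → {T (r <ᵇ length ρ)} →
             Reach 1 s (assign r (λ _ → k) s)
    simulate (const! {r} {k} f {r<l}) rep =
      single (const r k) f refl (represents-set r (<ᵇ⇒< _ _ r<l) refl rep)

    add! : ∀ {r a b} → fetch P p ≡ just (add r a b) →
           {T (r <ᵇ length ρ)} → {T (a <ᵇ length ρ)} → {T (b <ᵇ length ρ)} →
           Reach 1 s (assign r (λ ρ → get ρ a + get ρ b) s)
    simulate (add! {r} {a} {b} f {r<l} {a<l} {b<l}) rep =
      single (add r a b) f refl (represents-set r (<ᵇ⇒< _ _ r<l)
        (cong₂ _+_ (low rep (<ᵇ⇒< _ _ a<l)) (low rep (<ᵇ⇒< _ _ b<l))) rep)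

    sub! : ∀ {r a b} → fetch P p ≡ just (sub r a b) →
           {T (r <ᵇ length ρ)} → {T (a <ᵇ length ρ)} → {T (b <ᵇ length ρ)} →
           Reach 1 s (assign r (λ ρ → get ρ a ∸ get ρ b) s)
    simulate (sub! {r} {a} {b} f {r<l} {a<l} {b<l}) rep =
      single (sub r a b) f refl (represents-set r (<ᵇ⇒< _ _ r<l)
        (cong₂ _∸_ (low rep (<ᵇ⇒< _ _ a<l)) (low rep (<ᵇ⇒< _ _ b<l))) rep)

    load! : ∀ {r a} → fetch P p ≡ just (load r a) → ∀ i → get ρ a ≡ B + i →
            {T (r <ᵇ length ρ)} → {T (a <ᵇ length ρ)} →
            Reach 1 s (assign r (λ _ → g i) s)
    simulate (load! {r} {a} f i eq {r<l} {a<l}) {M} rep =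
      single (load r a) f refl (represents-set r (<ᵇ⇒< _ _ r<l)
        (trans (cong M (trans (low rep (<ᵇ⇒< _ _ a<l)) eq)) (high rep i)) rep)

    store! : ∀ {r a} → fetch P p ≡ just (store a r) → ∀ i → get ρ a ≡ B + i →
             {T (r <ᵇ length ρ)} → {T (a <ᵇ length ρ)} →
             Reach 1 s (write i r s)
    simulate (store! {r} {a} f i eq {r<l} {a<l}) rep =
      single (store a r) f refl (represents-store i (trans (low rep (<ᵇ⇒< _ _ a<l)) eq) (low rep (<ᵇ⇒< _ _ r<l)) rep)

    jmp! : ∀ {l} → fetch P p ≡ just (jmp l) → Reach 1 s (goto l s)
    simulate (jmp! {l} f) rep = single (jmp l) f refl rep

    jz-taken : ∀ {a l} → fetch P p ≡ just (jz a l) → get ρ a ≡ 0 → {T (a <ᵇ length ρ)} →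
               Reach 1 s (goto l s)
    simulate (jz-taken {a} {l} f eq {a<l}) {M} rep = single (jz a l) f taken rep
      where
      taken : exec (jz a l) (st p M) ≡ st l M
      taken rewrite trans (low rep (<ᵇ⇒< _ _ a<l)) eq = refl

    jz-skipped : ∀ {a l x} → fetch P p ≡ just (jz a l) → get ρ a ≡ suc x → {T (a <ᵇ length ρ)} →
                 Reach 1 s (skip s)
    simulate (jz-skipped {a} {l} f eq {a<l}) {M} rep = single (jz a l) f skipped rep
      where
      skipped : exec (jz a l) (st p M) ≡ st (suc p) M
      skipped rewrite trans (low rep (<ᵇ⇒< _ _ a<l)) eq = refl

-- The program

-- The input array starts at register 2, so there are no free registers.  With
-- S = m + n > 0, the address A = m + 16 S lies beyond the array and leaves m
-- recoverable as A − 16 S.  The first four array entries are saved at A, which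
-- frees the registers needed by the loop at 33 that copies the rest.  From 50 on,
-- the registers hold: 0 the number of swaps, 1 k, 2 the constant 1, 3 A, 4 m,
-- 5 hub m k, 6 i, 7 the remaining length of the sweep, 8–13 scratch values.  The
-- test at 61 works because array entries are at most k.
program : Program
program =
     add 1 0 1 ∷ jz 1 73 ∷ replicate 16 (add 0 0 1)
  ++ store 0 2
   ∷ const 2 1 ∷ add 2 0 2 ∷ store 2 3
   ∷ const 2 2 ∷ add 2 0 2 ∷ store 2 4
   ∷ const 2 3 ∷ add 2 0 2 ∷ store 2 5
   ∷ const 3 3 ∷ sub 3 1 3 ∷ const 2 6 ∷ const 4 4 ∷ add 4 0 4
   -- 33:
   ∷ jz 3 41 ∷ load 5 2 ∷ store 4 5 ∷ const 5 1 ∷ add 2 5 2 ∷ add 4 5 4 ∷ sub 3 3 5 ∷ jmp 33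
   -- 41:
   ∷ add 2 1 1 ∷ add 2 2 2 ∷ add 2 2 2 ∷ add 2 2 2 ∷ sub 4 0 2
   ∷ const 2 1 ∷ const 5 0 ∷ add 3 5 0 ∷ const 0 0
   -- 50:
   ∷ jz 1 73 ∷ sub 5 4 1 ∷ sub 5 4 5 ∷ const 6 0 ∷ add 7 6 1
   -- 55:
   ∷ jz 7 71 ∷ add 8 3 6 ∷ load 9 8 ∷ sub 10 1 9 ∷ add 6 2 6 ∷ sub 7 7 2 ∷ jz 10 63 ∷ jmp 55
   -- 63:
   ∷ sub 11 5 6 ∷ add 11 6 11 ∷ add 12 3 11 ∷ load 13 12 ∷ store 8 13 ∷ store 12 9 ∷ add 0 2 0 ∷ jmp 55
   -- 71:
   ∷ sub 1 1 2 ∷ jmp 50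
   ∷ []

-- Relocating the array

copy : ℕ → ℕ → ℕ → (ℕ → ℕ) → ℕ → ℕ
copy zero    x y g = g
copy (suc c) x y g = copy c (suc x) (suc y) (update g y (g x))

copy-below : ∀ c x y g {z} → z < y → copy c x y g z ≡ g z
copy-below zero    x y g z<y = refl
copy-below (suc c) x y g z<y = trans (copy-below c (suc x) (suc y) _ (m<n⇒m<1+n z<y)) (update-≢ g y (<⇒≢ z<y))

-- As `c + x ≤ y`, the source block ends before the target begins, and no entry is overwritten
-- before it is read.
copy-copied : ∀ c x y g {i} → c + x ≤ y → i < c → copy c x y g (y + i) ≡ g (x + i)
copy-copied (suc c) x y g {zero} c+x≤y _ rewrite +-identityʳ x | +-identityʳ y =
  trans (copy-below c (suc x) (suc y) _ ≤-refl) (update-≡ g y refl)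
copy-copied (suc c) x y g {suc i} c+x≤y (s≤s i<c) rewrite +-suc x i | +-suc y i =
  trans (copy-copied c (suc x) (suc y) _ (≤-trans (≤-reflexive (+-suc c x)) (≤-trans c+x≤y (n≤1+n y))) i<c)
        (update-≢ g y (<⇒≢ (<-≤-trans (s≤s 1+x+i≤c+x) c+x≤y)))
  where
  1+x+i≤c+x : suc x + i ≤ c + x
  1+x+i≤c+x = ≤-trans (≤-reflexive (trans (+-comm (suc x) i) (+-suc i x))) (+-monoˡ-≤ x i<c)

writeAll : ℕ → ℕ → List ℕ → (ℕ → ℕ) → ℕ → ℕ
writeAll a j []       g = g
writeAll a j (v ∷ vs) g = writeAll a (suc j) vs (update g (a + j) v)

writeAll-below : ∀ a j vs g {z} → z < a + j → writeAll a j vs g z ≡ g z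
writeAll-below a j []       g z<a+j = refl
writeAll-below a j (v ∷ vs) g z<a+j =
  trans (writeAll-below a (suc j) vs _ (<-≤-trans z<a+j (+-monoʳ-≤ a (n≤1+n j)))) (update-≢ g (a + j) (<⇒≢ z<a+j))

writeAll-written : ∀ a j vs g {i} → i < length vs → writeAll a j vs g (a + (j + i)) ≡ get vs i
writeAll-written a j (v ∷ vs) g {zero} _ rewrite +-identityʳ j =
  trans (writeAll-below a (suc j) vs _ (+-monoʳ-< a ≤-refl)) (update-≡ g (a + j) refl)
writeAll-written a j (v ∷ vs) g {suc i} (s≤s i<l) rewrite +-suc j i = writeAll-written a (suc j) vs _ i<l

-- The sum is nested as repeated `add 0 0 1` leaves it, so that blocks of four additions join by
-- computation.
addTimes : ℕ → ℕ → ℕ → ℕ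
addTimes zero    S m = m
addTimes (suc c) S m = addTimes c S m + S

addTimes≡ : ∀ c S m → addTimes c S m ≡ m + S * c
addTimes≡ zero    S m = sym (trans (cong (m +_) (*-zeroʳ S)) (+-identityʳ m))
addTimes≡ (suc c) S m = begin
  addTimes c S m + S ≡⟨ cong (_+ S) (addTimes≡ c S m) ⟩
  m + S * c + S      ≡⟨ +-assoc m (S * c) S ⟩
  m + (S * c + S)    ≡⟨ cong (m +_) (trans (+-comm (S * c) S) (sym (*-suc S c))) ⟩
  m + S * suc c      ∎
  where open ≡-Reasoning

module Prologue where
  open Simulation program 6

  -- x and y index the heap, which starts at address 6. An iteration takes eight instructions, the
  -- final test one.
  copy-loop : ∀ c x y {A S d z g} → d ≡ 6 + y → Σ (ℕ × ℕ × ℕ) λ (s , d′ , z′) →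
              Reach (c * 8 + 1) (conf 33 (A ∷ S ∷ 6 + x ∷ c ∷ d ∷ z ∷ []) g)
                                (conf 41 (A ∷ S ∷ s ∷ 0 ∷ d′ ∷ z′ ∷ []) (copy c x y g))
  copy-loop zero    x y d≡ = _ , jz-taken refl refl
  copy-loop (suc c) x y d≡ =
    let _ , rest = copy-loop c (suc x) (suc y) (cong suc d≡) in _ ,
    (jz-skipped refl refl ⨾ load! refl x refl ⨾ store! refl y d≡ ⨾ const! refl ⨾ add! refl ⨾ add! refl ⨾
     sub! refl ⨾ jmp! refl ⨾ rest)

  -- Of the S + 1 array entries, four sit in registers 2 to 5, which leaves `S ∸ 3` to copy. For a
  -- short array, surplus values from past its end are saved along with it.
  boot : ∀ m s a {v₀ v₁ v₂ v₃ g} → addTimes 16 (suc s) m ≡ 6 + a → Σ (ℕ × ℕ × ℕ) λ (x , y , z) →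
         Reach (s * 8 + 33)
           (conf 1 (m ∷ suc s ∷ v₀ ∷ v₁ ∷ v₂ ∷ v₃ ∷ []) g)
           (conf 41 (addTimes 16 (suc s) m ∷ suc s ∷ x ∷ 0 ∷ y ∷ z ∷ [])
                    (copy (suc s ∸ 3) 0 (a + 4) (writeAll a 0 (v₀ ∷ v₁ ∷ v₂ ∷ v₃ ∷ []) g)))
  boot m s a {v₀} {v₁} {v₂} {v₃} {g} base≡ =
    let _ , rest = copy-loop (suc s ∸ 3) 0 (a + 4) (address 4) in _ ,
    weaken bound
    ( conf 1 (m ∷ S ∷ free) g             ⇒⟨ jz-skipped refl refl ⨾ four-adds refl refl refl refl ⟩
      conf 6 (addTimes 4 S m ∷ S ∷ free) g    ⇒⟨ four-adds refl refl refl refl ⟩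
      conf 10 (addTimes 8 S m ∷ S ∷ free) g   ⇒⟨ four-adds refl refl refl refl ⟩
      conf 14 (addTimes 12 S m ∷ S ∷ free) g  ⇒⟨ four-adds refl refl refl refl ⟩
      conf 18 (A ∷ S ∷ free) g
        ⇒⟨ store! refl (a + 0) (trans base≡ (cong (6 +_) (sym (+-identityʳ a)))) ⨾
           const! refl ⨾ add! refl ⨾ store! refl (a + 1) (address 1) ⟩
      conf 22 (A ∷ S ∷ A + 1 ∷ v₁ ∷ v₂ ∷ v₃ ∷ []) _
        ⇒⟨ const! refl ⨾ add! refl ⨾ store! refl (a + 2) (address 2) ⟩
      conf 25 (A ∷ S ∷ A + 2 ∷ v₁ ∷ v₂ ∷ v₃ ∷ []) _
        ⇒⟨ const! refl ⨾ add! refl ⨾ store! refl (a + 3) (address 3) ⟩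
      conf 28 (A ∷ S ∷ A + 3 ∷ v₁ ∷ v₂ ∷ v₃ ∷ []) (writeAll a 0 (v₀ ∷ v₁ ∷ v₂ ∷ v₃ ∷ []) g)
        ⇒⟨ const! refl ⨾ sub! refl ⨾ const! refl ⨾ const! refl ⨾ add! refl ⟩
      conf 33 (A ∷ S ∷ 6 ∷ S ∸ 3 ∷ A + 4 ∷ v₃ ∷ []) (writeAll a 0 (v₀ ∷ v₁ ∷ v₂ ∷ v₃ ∷ []) g)
        ⇒⟨ rest ⟩■)
    where
    S = suc s
    A = addTimes 16 S m
    free = v₀ ∷ v₁ ∷ v₂ ∷ v₃ ∷ []
    address : ∀ j → A + j ≡ 6 + (a + j)
    address j = cong (_+ j) base≡
    -- The instructions at 1 to 32 run once each before the loop, and `S ∸ 3` is at most s.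
    bound : 32 + ((S ∸ 3) * 8 + 1) ≤ s * 8 + 33
    bound = ≤-trans (≤-reflexive (trans (+-comm 32 _) (+-assoc _ 1 32)))
              (+-monoˡ-≤ 33 (*-monoˡ-≤ 8 (m∸n≤m s 2)))
    four-adds : ∀ {p x} → fetch program p ≡ just (add 0 0 1) → fetch program (1 + p) ≡ just (add 0 0 1) →
                fetch program (2 + p) ≡ just (add 0 0 1) → fetch program (3 + p) ≡ just (add 0 0 1) →
                Reach 4 (conf p (x ∷ S ∷ free) g) (conf (4 + p) (addTimes 4 S x ∷ S ∷ free) g)
    four-adds e₀ e₁ e₂ e₃ = add! e₀ ⨾ add! e₁ ⨾ add! e₂ ⨾ add! e₃

  -- The first four entries were saved below the target of the copy; the others come from sources
  -- below a, which the saves did not touch.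
  relocated : ∀ (M : ℕ → ℕ) s a → s < a → ∀ {i} → i < 2 + s →
              copy (suc s ∸ 3) 0 (a + 4) (writeAll a 0 (M 2 ∷ M 3 ∷ M 4 ∷ M 5 ∷ []) (λ i → M (6 + i))) (a + i) ≡
              M (2 + i)
  relocated M s a s<a {i} i<2+s with i <? 4
  ... | yes i<4 = trans (copy-below (suc s ∸ 3) 0 (a + 4) _ (+-monoʳ-< a i<4))
                        (trans (writeAll-written a 0 (M 2 ∷ M 3 ∷ M 4 ∷ M 5 ∷ []) (λ i → M (6 + i)) i<4) (entry i<4))
    where
    entry : ∀ {i} → i < 4 → get (M 2 ∷ M 3 ∷ M 4 ∷ M 5 ∷ []) i ≡ M (2 + i)
    entry {0} _ = refl
    entry {1} _ = refl
    entry {2} _ = refl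
    entry {3} _ = refl
    entry {suc (suc (suc (suc _)))} (s≤s (s≤s (s≤s (s≤s ()))))
  ... | no i≮4 with m≤n⇒∃[o]m+o≡n (≮⇒≥ i≮4)
  ...   | i , refl = begin
      copy (suc s ∸ 3) 0 (a + 4) h (a + (4 + i)) ≡⟨ cong (copy (suc s ∸ 3) 0 (a + 4) h) (+-assoc a 4 i) ⟨
      copy (suc s ∸ 3) 0 (a + 4) h (a + 4 + i)   ≡⟨ copy-copied (suc s ∸ 3) 0 (a + 4) h apart (∸-monoˡ-≤ 3 (s≤s⁻¹ i<2+s)) ⟩
      h i                                        ≡⟨ writeAll-below a 0 (M 2 ∷ M 3 ∷ M 4 ∷ M 5 ∷ []) (λ i → M (6 + i)) (≤-trans i<a (m≤m+n a 0)) ⟩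
      M (6 + i)                                  ∎
      where
      open ≡-Reasoning
      h = writeAll a 0 (M 2 ∷ M 3 ∷ M 4 ∷ M 5 ∷ []) (λ i → M (6 + i))
      i<a : i < a
      i<a = ≤-trans (m≤n+m (suc i) 3) (≤-trans (s≤s⁻¹ i<2+s) s<a)
      apart : suc s ∸ 3 + 0 ≤ a + 4
      apart = ≤-trans (≤-reflexive (+-identityʳ _)) (≤-trans (m∸n≤m (suc s) 3) (≤-trans s<a (m≤m+n a 4)))

-- The sorting loops

-- Exchanging two entries composes `g` with the transposition on the inside, hence `q` on the
-- outside. The updates are nested in the order of the program's two stores.
inverse-swap : ∀ {N g q i j} → i < N → j < N → Inverse N g q →
               Inverse N (update (update g i (g j)) j (g i)) (transpose i j ∘ q)
inverse-swap {N} {g} {q} {i} {j} i<N j<N inv = record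
  { embeds  = transpose-embeds i<N j<N (embeds inv)
  ; g-bound = λ {x} x<N → subst (_< N) (sym (swapped x)) (g-bound inv (transpose-< i<N j<N x<N))
  ; q∘g     = λ {x} x<N → begin
      transpose i j (q (g′ x))              ≡⟨ cong (transpose i j ∘ q) (swapped x) ⟩
      transpose i j (q (g (transpose i j x))) ≡⟨ cong (transpose i j) (q∘g inv (transpose-< i<N j<N x<N)) ⟩
      transpose i j (transpose i j x)       ≡⟨ transpose-involutive i j x ⟩
      x                                     ∎
  ; g∘q     = λ {t} t<N → begin
      g′ (transpose i j (q t))              ≡⟨ swapped (transpose i j (q t)) ⟩
      g (transpose i j (transpose i j (q t))) ≡⟨ cong g (transpose-involutive i j (q t)) ⟩
      g (q t)                               ≡⟨ g∘q inv t<N ⟩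
      t                                     ∎
  }
  where
  open ≡-Reasoning
  g′ = update (update g i (g j)) j (g i)
  swapped : ∀ x → g′ x ≡ g (transpose i j x)
  swapped x = by-cases (x ≟ j) (x ≟ i)
    where
    by-cases : Dec (x ≡ j) → Dec (x ≡ i) → g′ x ≡ g (transpose i j x)
    by-cases (yes refl) _          = trans (update-≡ (update g i (g j)) j refl) (cong g (sym (transpose-matchʳ i j)))
    by-cases (no x≢j)   (yes refl) = trans (update-≢ (update g i (g j)) j x≢j)
                                       (trans (update-≡ g i refl) (cong g (sym (transpose-matchˡ i j))))
    by-cases (no x≢j)   (no x≢i)   = trans (update-≢ (update g i (g j)) j x≢j)
                                       (trans (update-≢ g i x≢i) (cong g (sym (transpose-mismatch x≢i x≢j))))

fixing-top-inverse : ∀ {k g q} → Inverse (suc k) g q → q k ≡ k → Inverse k g q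
fixing-top-inverse {k} {g} {q} inv qk≡k = record
  { embeds  = fixing-top-embeds (embeds inv) qk≡k
  ; g-bound = λ i<k → ≤∧≢⇒< (s≤s⁻¹ (g-bound inv (m<n⇒m<1+n i<k)))
                (λ e → <⇒≢ i<k (trans (sym (q∘g inv (m<n⇒m<1+n i<k))) (trans (cong q e) qk≡k)))
  ; q∘g     = λ i<k → q∘g inv (m<n⇒m<1+n i<k)
  ; g∘q     = λ t<k → g∘q inv (m<n⇒m<1+n t<k)
  }

-- In each round 5 instructions prepare the sweep, each vertex takes at most 15, rounded up to 16,
-- the closing test takes one, and 2 lead to the next round.
sort-time : ℕ → ℕ
sort-time zero    = 1
sort-time (suc k) = 5 + (suc k * 16 + 1 + (2 + sort-time k))

module Main (A m : ℕ) where
  open Simulation program A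

  state : ℕ → (cnt k h i c x₁ x₂ x₃ x₄ x₅ x₆ : ℕ) → (ℕ → ℕ) → Conf
  state p cnt k h i c x₁ x₂ x₃ x₄ x₅ x₆ =
    conf p (cnt ∷ k ∷ 1 ∷ A ∷ m ∷ h ∷ i ∷ c ∷ x₁ ∷ x₂ ∷ x₃ ∷ x₄ ∷ x₅ ∷ x₆ ∷ [])

  record SweepFrom (b : ℕ) (s : Conf) (k cnt : ℕ) (q : ℕ → ℕ) : Set where
    field
      {cnt′ i′ x₁ x₂ x₃ x₄ x₅ x₆} : ℕ
      {g′ q′} : ℕ → ℕ
      reaches : Reach b s (state 71 cnt′ k (hub m k) i′ 0 x₁ x₂ x₃ x₄ x₅ x₆ g′)
      counts  : cnt′ ≡ dist (hub m k) k (q k) + cnt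
      inverse : Inverse (suc k) g′ q′
      settled : q′ k ≡ k
      others  : ∀ {t} → t < k → q′ t ≡ bypass (hub m k) (q k) (q t)
  open SweepFrom

  -- The invariant `i ≤ q k` says that token k has not been passed. A swap sends it from i to
  -- `next h i`, beyond i, so a single sweep carries it to k.
  sweep : ∀ c i k {cnt x₁ x₂ x₃ x₄ x₅ x₆ g q} → c + i ≡ k → i ≤ q k → Inverse (suc k) g q →
          SweepFrom (c * 16 + 1) (state 55 cnt k (hub m k) i c x₁ x₂ x₃ x₄ x₅ x₆ g) k cnt q
  sweep zero i k {cnt} {q = q} refl i≤p inv = record
    { reaches = jz-taken refl refl
    ; counts  = cong (_+ cnt) (sym (trans (cong (dist (hub m k) k) p≡k) (dist-goal (hub≤k m k))))
    ; inverse = inv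
    ; settled = p≡k
    ; others  = λ {t} t<k → sym (trans (cong (λ p → bypass (hub m k) p (q t)) p≡k)
                  (bypass-below (hub m k) k (<-≤-trans (bounded (fixing-top-embeds (embeds inv) p≡k) t<k) (m≤n⊔m (hub m k) k))))
    }
    where
    p≡k : q k ≡ k
    p≡k = ≤-antisym (s≤s⁻¹ (bounded (embeds inv) ≤-refl)) i≤p
  sweep (suc c) i k {cnt} {x₁} {x₂} {x₃} {x₄} {x₅} {x₆} {g} {q} c+i≡k i≤p inv = by-cases (k ∸ g i) refl
    where
    h = hub m k
    i<k : i < k
    i<k = ≤-trans (s≤s (m≤n+m i c)) (≤-reflexive c+i≡k)
    scan : Reach 6 (state 55 cnt k h i (suc c) x₁ x₂ x₃ x₄ x₅ x₆ g)
                   (state 61 cnt k h (suc i) c (A + i) (g i) (k ∸ g i) x₄ x₅ x₆ g)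
    scan = jz-skipped refl refl ⨾ add! refl ⨾ load! refl i refl ⨾ sub! refl ⨾ add! refl ⨾ sub! refl
    -- Since `g i ≤ k`, the truncated difference is zero exactly when vertex i holds token k.
    by-cases : ∀ d → k ∸ g i ≡ d →
               SweepFrom (suc c * 16 + 1) (state 55 cnt k h i (suc c) x₁ x₂ x₃ x₄ x₅ x₆ g) k cnt q
    by-cases (suc d) k∸gi = record
      { reaches = weaken (+-monoˡ-≤ (c * 16 + 1) (m≤m+n 8 8))
          ( state 55 cnt k h i (suc c) x₁ x₂ x₃ x₄ x₅ x₆ g                     ⇒⟨ scan ⟩
            state 61 cnt k h (suc i) c (A + i) (g i) (k ∸ g i) x₄ x₅ x₆ g      ⇒⟨ jz-skipped refl k∸gi ⨾ jmp! refl ⟩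
            state 55 cnt k h (suc i) c (A + i) (g i) (k ∸ g i) x₄ x₅ x₆ g      ⇒⟨ reaches rest ⟩■)
      ; counts  = counts rest
      ; inverse = inverse rest
      ; settled = settled rest
      ; others  = others rest
      }
      where
      i≢p : i ≢ q k
      i≢p i≡p = 0≢1+n (trans (sym (n∸n≡0 k)) (trans (cong (k ∸_) (sym (trans (cong g i≡p) (g∘q inv ≤-refl)))) k∸gi))
      rest = sweep c (suc i) k {cnt} {A + i} {g i} {k ∸ g i} {x₄} {x₅} {x₆}
                   (trans (+-suc c i) c+i≡k) (≤∧≢⇒< i≤p i≢p) inv
    by-cases zero k∸gi = record
      { reaches = weaken (+-monoˡ-≤ (c * 16 + 1) (m≤m+n 15 1))
          ( state 55 cnt k h i (suc c) x₁ x₂ x₃ x₄ x₅ x₆ g                     ⇒⟨ scan ⟩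
            state 61 cnt k h (suc i) c (A + i) (g i) (k ∸ g i) x₄ x₅ x₆ g
              ⇒⟨ jz-taken refl k∸gi ⨾ sub! refl ⨾ add! refl ⨾ add! refl ⨾ load! refl j refl ⟩
            state 67 cnt k h (suc i) c (A + i) (g i) (k ∸ g i) j (A + j) (g j) g
              ⇒⟨ store! refl i refl ⨾ store! refl j refl ⨾ add! refl ⨾ jmp! refl ⟩
            state 55 (suc cnt) k h (suc i) c (A + i) (g i) (k ∸ g i) j (A + j) (g j) g₁ ⇒⟨ reaches rest ⟩■)
      -- The increment of the counter pays for j being one step closer to k than i.
      ; counts  = trans (counts rest) (trans (cong (λ p → dist h k p + suc cnt) q₁k≡j) (trans (+-suc _ cnt)
                    (cong (_+ cnt) (trans (sym (dist-next {h} i<k)) (cong (dist h k) (sym p≡i))))))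
      ; inverse = inverse rest
      ; settled = settled rest
      ; others  = λ {t} t<k → trans (others rest t<k)
          (trans (cong (λ p → bypass h p (q₁ t)) q₁k≡j)
            (trans (bypass-next h i (λ qt≡i → avoids-top (embeds inv) t<k (trans qt≡i (sym p≡i))))
                   (cong (λ p → bypass h p (q t)) (sym p≡i))))
      }
      where
      j = next h i
      g₁ = update (update g i (g j)) j (g i)
      q₁ = transpose i j ∘ q
      gi≡k : g i ≡ k
      gi≡k = ≤-antisym (s≤s⁻¹ (g-bound inv (m<n⇒m<1+n i<k))) (m∸n≡0⇒m≤n k∸gi)
      p≡i : q k ≡ i
      p≡i = trans (cong q (sym gi≡k)) (q∘g inv (m<n⇒m<1+n i<k))
      q₁k≡j : q₁ k ≡ j
      q₁k≡j = trans (cong (transpose i j) p≡i) (transpose-matchˡ i j)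
      rest = sweep c (suc i) k {suc cnt} {A + i} {g i} {k ∸ g i} {j} {A + j} {g j}
                   (trans (+-suc c i) c+i≡k) (subst (suc i ≤_) (sym q₁k≡j) (m≤m+n (suc i) _))
                   (inverse-swap (m<n⇒m<1+n i<k) (s≤s (next-≤ (hub≤k m k) i<k)) inv)

  record SortFrom (b : ℕ) (s : Conf) (k cnt : ℕ) (q : ℕ → ℕ) : Set where
    field
      {cnt′ h′ i′ c′ x₁ x₂ x₃ x₄ x₅ x₆} : ℕ
      {g′} : ℕ → ℕ
      reaches : Reach b s (state 73 cnt′ 0 h′ i′ c′ x₁ x₂ x₃ x₄ x₅ x₆ g′)
      counts  : cnt′ ≡ cost m (suc k) q + cnt

  -- Each round adds the distance of its token, the first summand of `cost`, and leaves the
  -- positions with which the recursion of `cost` continues.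
  sort : ∀ k {cnt h i c x₁ x₂ x₃ x₄ x₅ x₆ g q} → Inverse (suc k) g q →
         SortFrom (sort-time k) (state 50 cnt k h i c x₁ x₂ x₃ x₄ x₅ x₆ g) k cnt q
  sort zero {cnt} {q = q} inv = record
    { reaches = jz-taken refl refl
    ; counts  = cong (_+ cnt) (sym (cost-identity m 1 (embeds inv) fixed))
    }
    where
    fixed : ∀ {t} → t < 1 → q t ≡ t
    fixed (s≤s z≤n) = n<1⇒n≡0 (bounded (embeds inv) ≤-refl)
  sort (suc k) {cnt} {h} {i} {c} {x₁} {x₂} {x₃} {x₄} {x₅} {x₆} {g} {q} inv = record
    { reaches =
        state 50 cnt (suc k) h i c x₁ x₂ x₃ x₄ x₅ x₆ g
          ⇒⟨ jz-skipped refl refl ⨾ sub! refl ⨾ sub! refl ⨾ const! refl ⨾ add! refl ⟩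
        state 55 cnt (suc k) (hub m (suc k)) 0 (suc k) x₁ x₂ x₃ x₄ x₅ x₆ g
          ⇒⟨ reaches swept ⟩
        state 71 (cnt′ swept) (suc k) (hub m (suc k)) _ 0 _ _ _ _ _ _ _
          ⇒⟨ sub! refl ⨾ jmp! refl ⟩
        state 50 (cnt′ swept) k (hub m (suc k)) _ 0 _ _ _ _ _ _ _
          ⇒⟨ SortFrom.reaches sorted ⟩■
    ; counts  = begin
        SortFrom.cnt′ sorted                               ≡⟨ SortFrom.counts sorted ⟩
        cost m (suc k) (q′ swept) + cnt′ swept             ≡⟨ cong (cost m (suc k) (q′ swept) +_) (counts swept) ⟩
        cost m (suc k) (q′ swept) + (d + cnt)              ≡⟨ +-assoc (cost m (suc k) (q′ swept)) d cnt ⟨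
        cost m (suc k) (q′ swept) + d + cnt                ≡⟨ cong (_+ cnt) (+-comm (cost m (suc k) (q′ swept)) d) ⟩
        d + cost m (suc k) (q′ swept) + cnt                ≡⟨ cong (_+ cnt) (cost-step m (suc k) {q} {q′ swept} refl (others swept)) ⟨
        cost m (suc (suc k)) q + cnt                       ∎
    }
    where
    open ≡-Reasoning
    d = dist (hub m (suc k)) (suc k) (q (suc k))
    swept = sweep (suc k) 0 (suc k) {cnt} {x₁} {x₂} {x₃} {x₄} {x₅} {x₆} (+-identityʳ (suc k)) z≤n inv
    sorted = sort k (fixing-top-inverse (inverse swept) (settled swept))

-- Time bounds

sort-time-≤ : ∀ k → sort-time k ≤ 24 * (suc k * suc k)
sort-time-≤ zero    = s≤s z≤n
sort-time-≤ (suc k) = begin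
  5 + (suc k * 16 + 1 + (2 + sort-time k))                 ≤⟨ +-monoʳ-≤ 5 (+-monoʳ-≤ (suc k * 16 + 1) (+-monoʳ-≤ 2 (sort-time-≤ k))) ⟩
  -- The added term is the exact difference of the two sides, which leaves a ring identity.
  5 + (suc k * 16 + 1 + (2 + 24 * (suc k * suc k)))        ≤⟨ m≤m+n _ (48 + 32 * k) ⟩
  5 + (suc k * 16 + 1 + (2 + 24 * (suc k * suc k))) + (48 + 32 * k) ≡⟨ expand k ⟩
  24 * (suc (suc k) * suc (suc k))                         ∎
  where
  open ≤-Reasoning
  expand : ∀ k → 5 + ((1 + k) * 16 + 1 + (2 + 24 * ((1 + k) * (1 + k)))) + (48 + 32 * k) ≡
                 24 * ((2 + k) * (2 + k))
  expand = solve-∀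

-- The summands are the first instruction, the relocation, the 9 instructions of `setup`, and the
-- sorting.
total-≤ : ∀ s → 1 + (s * 8 + 33 + (9 + sort-time (suc s))) ≤ 100 * suc (suc s) ^ 2
total-≤ s = begin
  1 + (s * 8 + 33 + (9 + sort-time (suc s)))                       ≤⟨ +-monoʳ-≤ 1 (+-monoʳ-≤ (s * 8 + 33) (+-monoʳ-≤ 9 (sort-time-≤ (suc s)))) ⟩
  1 + (s * 8 + 33 + (9 + 24 * (suc (suc s) * suc (suc s))))        ≤⟨ m≤m+n _ (261 + 296 * s + 76 * (s * s)) ⟩
  1 + (s * 8 + 33 + (9 + 24 * (suc (suc s) * suc (suc s)))) + (261 + 296 * s + 76 * (s * s)) ≡⟨ expand s ⟩
  100 * suc (suc s) ^ 2                                            ∎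
  where
  open ≤-Reasoning
  expand : ∀ s → 1 + (s * 8 + 33 + (9 + 24 * ((2 + s) * (2 + s)))) + (261 + 296 * s + 76 * (s * s)) ≡
                 100 * ((2 + s) * ((2 + s) * 1))
  expand = solve-∀

-- Joining the relocation to the sorting loops

inverse-cong : ∀ {N g g′ q} → (∀ {i} → i < N → g′ i ≡ g i) → Inverse N g q → Inverse N g′ q
inverse-cong {N} {q = q} eq inv = record
  { embeds  = embeds inv
  ; g-bound = λ i<N → subst (_< N) (sym (eq i<N)) (g-bound inv i<N)
  ; q∘g     = λ i<N → trans (cong q (eq i<N)) (q∘g inv i<N)
  ; g∘q     = λ t<N → trans (eq (bounded (embeds inv) t<N)) (g∘q inv t<N)
  }

double : ℕ → ℕ
double x = x + x

doubled : ∀ S → double (double (double (double S))) ≡ S * 16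
doubled = expand
  where
  expand : ∀ S → ((S + S) + (S + S)) + ((S + S) + (S + S)) + (((S + S) + (S + S)) + ((S + S) + (S + S))) ≡ S * 16
  expand = solve-∀

setup : ∀ A m S {x y z g w₀ w₁ w₂ w₃ w₄ w₅ w₆ w₇} → A ≡ m + S * 16 → let open Simulation program A in
        Reach 9 (conf 41 (A ∷ S ∷ x ∷ 0 ∷ y ∷ z ∷ w₀ ∷ w₁ ∷ w₂ ∷ w₃ ∷ w₄ ∷ w₅ ∷ w₆ ∷ w₇ ∷ []) g)
                (Main.state A m 50 0 S 0 w₀ w₁ w₂ w₃ w₄ w₅ w₆ w₇ g)
setup A m S {x} {y} {z} {g} {w₀} {w₁} {w₂} {w₃} {w₄} {w₅} {w₆} {w₇} A≡ =
  conf 41 (A ∷ S ∷ x ∷ 0 ∷ y ∷ z ∷ free) g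
    ⇒⟨ add! refl ⨾ add! refl ⨾ add! refl ⨾ add! refl ⟩
  conf 45 (A ∷ S ∷ S₁₆ ∷ 0 ∷ y ∷ z ∷ free) g
    ⇒⟨ subst (λ v → Reach 1 (conf 45 (A ∷ S ∷ S₁₆ ∷ 0 ∷ y ∷ z ∷ free) g)
                          (conf 46 (A ∷ S ∷ S₁₆ ∷ 0 ∷ v ∷ z ∷ free) g)) A∸S₁₆≡m (sub! refl) ⟩
  conf 46 (A ∷ S ∷ S₁₆ ∷ 0 ∷ m ∷ z ∷ free) g
    -- A is moved to register 3 by adding it to the zeroed register 5, and `0 + A` computes to A.
    ⇒⟨ const! refl ⨾ const! refl ⨾ add! refl ⨾ const! refl ⟩■
  where
  open Simulation program A
  free = w₀ ∷ w₁ ∷ w₂ ∷ w₃ ∷ w₄ ∷ w₅ ∷ w₆ ∷ w₇ ∷ []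
  S₁₆ = double (double (double (double S)))
  A∸S₁₆≡m : A ∸ S₁₆ ≡ m
  A∸S₁₆≡m = trans (cong₂ _∸_ A≡ (doubled S)) (m+n∸n≡m m (S * 16))

represents-initial : ∀ M → Represents 6 (M 0 ∷ M 1 ∷ M 2 ∷ M 3 ∷ M 4 ∷ M 5 ∷ []) (λ i → M (6 + i)) M
represents-initial M = record { low = low′ ; high = λ _ → refl ; gap = ≤-refl }
  where
  low′ : ∀ {r} → r < 6 → M r ≡ get (M 0 ∷ M 1 ∷ M 2 ∷ M 3 ∷ M 4 ∷ M 5 ∷ []) r
  low′ {0} _ = refl
  low′ {1} _ = refl
  low′ {2} _ = refl
  low′ {3} _ = refl
  low′ {4} _ = refl
  low′ {5} _ = refl
  low′ {suc (suc (suc (suc (suc (suc _)))))} (s≤s (s≤s (s≤s (s≤s (s≤s (s≤s ()))))))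

-- The same memory is seen from a larger base: heap cells 0 to 7 turn into registers 6 to 13, and
-- the new heap starts at A.
represents-more : ∀ {A b ρ₀ ρ₁ ρ₂ ρ₃ ρ₄ ρ₅ g M} → A ≡ 14 + b →
  Represents 6 (ρ₀ ∷ ρ₁ ∷ ρ₂ ∷ ρ₃ ∷ ρ₄ ∷ ρ₅ ∷ []) g M →
  Represents A (ρ₀ ∷ ρ₁ ∷ ρ₂ ∷ ρ₃ ∷ ρ₄ ∷ ρ₅ ∷ g 0 ∷ g 1 ∷ g 2 ∷ g 3 ∷ g 4 ∷ g 5 ∷ g 6 ∷ g 7 ∷ [])
             (λ i → g (8 + b + i)) M
represents-more {b = b} {ρ₀} {ρ₁} {ρ₂} {ρ₃} {ρ₄} {ρ₅} {g} {M} refl rep =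
  record { low = low′ ; high = λ i → high rep (8 + b + i) ; gap = m≤m+n 14 b }
  where
  low′ : ∀ {r} → r < 14 →
         M r ≡ get (ρ₀ ∷ ρ₁ ∷ ρ₂ ∷ ρ₃ ∷ ρ₄ ∷ ρ₅ ∷ g 0 ∷ g 1 ∷ g 2 ∷ g 3 ∷ g 4 ∷ g 5 ∷ g 6 ∷ g 7 ∷ []) r
  low′ {0}  _ = low rep (<ᵇ⇒< 0 6 _)
  low′ {1}  _ = low rep (<ᵇ⇒< 1 6 _)
  low′ {2}  _ = low rep (<ᵇ⇒< 2 6 _)
  low′ {3}  _ = low rep (<ᵇ⇒< 3 6 _)
  low′ {4}  _ = low rep (<ᵇ⇒< 4 6 _)
  low′ {5}  _ = low rep (<ᵇ⇒< 5 6 _)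
  low′ {6}  _ = high rep 0
  low′ {7}  _ = high rep 1
  low′ {8}  _ = high rep 2
  low′ {9}  _ = high rep 3
  low′ {10} _ = high rep 4
  low′ {11} _ = high rep 5
  low′ {12} _ = high rep 6
  low′ {13} _ = high rep 7
  low′ {suc (suc (suc (suc (suc (suc (suc (suc (suc (suc (suc (suc (suc (suc r)))))))))))))} r<14 =
    contradiction (m≤m+n 14 r) (<⇒≱ r<14)

run-halts : ∀ P {t t′ s p M} → t ≤ t′ → (∀ j → run P (t + j) s ≡ run P j (st p M)) → fetch P p ≡ nothing →
            run P t′ s ≡ just (st p M)
run-halts P {t} {t′} {s} t≤t′ runs halted =
  trans (cong (λ u → run P u s) (sym (m+[n∸m]≡n t≤t′))) (trans (runs (t′ ∸ t)) (run-halted P (t′ ∸ t) halted))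

-- For S = 0 the program halts at its first test; register 0 then holds m + n = 0, the correct
-- answer for a single vertex.
computes-cost : ∀ m S M {q} → M 0 ≡ m → M 0 + M 1 ≡ S → Inverse (suc S) (λ i → M (2 + i)) q →
                Σ State λ s → run program (100 * suc S ^ 2) (st 0 M) ≡ just s × mem s 0 ≡ cost m (suc S) q
computes-cost _ zero M {q} refl sum inv =
  let _ , M′ , t≤2 , rep , runs = simulate halt (represents-initial M) in
  st 73 M′ , run-halts program {s = st 0 M} {M = M′} (≤-trans t≤2 (m≤m+n 2 98)) runs refl ,
  trans (low rep (s≤s z≤n)) (trans (m+n≡0⇒m≡0 (M 0) sum) (sym (cost-identity (M 0) 1 (embeds inv) fixed)))
  where
  open Simulation program 6
  initial = conf 0 (M 0 ∷ M 1 ∷ M 2 ∷ M 3 ∷ M 4 ∷ M 5 ∷ []) (λ i → M (6 + i))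
  halt : Reach 2 initial _
  halt = add! refl ⨾ jz-taken refl sum
  fixed : ∀ {t} → t < 1 → q t ≡ t
  fixed (s≤s z≤n) = n<1⇒n≡0 (bounded (embeds inv) ≤-refl)
computes-cost _ (suc s) M {q} refl sum inv =
  let t₀ , M₀ , t₀≤ , rep₀ , run₀ = Low.simulate start (represents-initial M)
      t₁ , M₁ , t₁≤ , rep₁ , run₁ = High.simulate finish (represents-more base≡ rep₀)
  in st 73 M₁ ,
     run-halts program {s = st 0 M} {M = M₁} (≤-trans (+-mono-≤ t₀≤ t₁≤) (total-≤ s))
       (λ j → trans (cong (λ u → run program u (st 0 M)) (+-assoc t₀ t₁ j)) (trans (run₀ (t₁ + j)) (run₁ j))) refl ,
     trans (low rep₁ (s≤s z≤n)) (trans (Main.SortFrom.counts sorted) (+-identityʳ _))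
  where
  module Low = Simulation program 6
  m = M 0
  -- This is A - 14: as S is positive, adding 16 S puts A beyond the fourteen working registers.
  b = 2 + (m + s * 16)
  A = addTimes 16 (suc s) m
  module High = Simulation program A
  base≡ : A ≡ 14 + b
  base≡ = begin
    A                  ≡⟨ addTimes≡ 16 (suc s) m ⟩
    m + (16 + s * 16)  ≡⟨ +-assoc m 16 (s * 16) ⟨
    m + 16 + s * 16    ≡⟨ cong (_+ s * 16) (+-comm m 16) ⟩
    14 + b             ∎
    where open ≡-Reasoning
  booted = Prologue.boot m s (8 + b) {M 2} {M 3} {M 4} {M 5} {λ i → M (6 + i)} base≡
  initial = conf 0 (M 0 ∷ M 1 ∷ M 2 ∷ M 3 ∷ M 4 ∷ M 5 ∷ []) (λ i → M (6 + i))
  start : Low.Reach (1 + (s * 8 + 33)) initial _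
  start = subst (λ S → Low.Reach 1 initial (conf 1 (m ∷ S ∷ M 2 ∷ M 3 ∷ M 4 ∷ M 5 ∷ []) (λ i → M (6 + i)))) sum
                (Low.add! refl)
          Low.⨾ proj₂ booted
  g : ℕ → ℕ
  g = copy (suc s ∸ 3) 0 (8 + b + 4) (writeAll (8 + b) 0 (M 2 ∷ M 3 ∷ M 4 ∷ M 5 ∷ []) (λ i → M (6 + i)))
  s<8+b : s < 8 + b
  s<8+b = s≤s (≤-trans (m≤m*n s 16) (≤-trans (m≤n+m (s * 16) m) (m≤n+m (m + s * 16) 9)))
  array : ∀ {i} → i < 2 + s → g (8 + b + i) ≡ M (2 + i)
  array = Prologue.relocated M s (8 + b) s<8+b
  sorted = Main.sort A m (suc s) {0} {0} {g 0} {g 1} {g 2} {g 3} {g 4} {g 5} {g 6} {g 7} (inverse-cong array inv)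
  finish : High.Reach (9 + sort-time (suc s)) _ _
  finish = setup A m (suc s) (addTimes≡ 16 (suc s) m) High.⨾ Main.SortFrom.reaches sorted

theorem13 : Σ Program (λ P → Σ ℕ (λ c → Σ ℕ (λ d →
    (m n : ℕ) (f : Config m n) → Bijective _≡_ _≡_ f →
    Σ State (λ s →
    run P (c * (suc (m + n)) ^ d) (initState m n f) ≡ just s
    × IsTS m n f (mem s 0)))))
theorem13 = program , 100 , 2 , λ m n f bij →
  let inverse = position-inverse {m} {n} f bij {λ i → inputMem m n f (2 + i)} (inputMem-toℕ m n f)
      s , halts , result = computes-cost m (m + n) (inputMem m n f) refl refl inverse
  in s , halts , subst (IsTS m n f) (sym result) (cost-isTS m n (embeds inverse) (position-positions {m} {n} f bij))
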